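{- For every $\epsilon \in (0,1)$ there is a two-party randomized communication protocol such that, when Alice holds $A \in \{0,1\}^{n\times n}$ and Bob holds $B \in \{0,1\}^{n\times n}$, the protocol performs $\ell_0$-sampling on $C = AB$ with success probability $0.9$, using $\tilde{O}(n/\epsilon^2)$ bits of communication and $1$ round.
   Context: Two-party communication model: Alice knows only her input and Bob knows only his; each has private randomness; they exchange messages and at the end the output is produced. The communication cost is the total number of bits of all messages (worst case over inputs and randomness); the number of rounds is the number of messages sent (a 1-round protocol consists of a single message from Alice to Bob, who then outputs the answer). The matrix product $C=A\cdot B$ is over the integers, and $\|C\|_0$ is the number of non-zero entries of $C$. The $\ell_0$-sampling problem on $C$ is to output a random non-zero entry (position $(i,j)$) of $C$ such that each non-zero entry is output with probability $(1\pm\epsilon)\frac{1}{\|C\|_0}$, i.e. with probability in $\left[\frac{1-\epsilon}{\|C\|_0}, \frac{1+\epsilon}{\|C\|_0}\right]$. Success probability $0.9$ means that for every input, there is an event of probability at least $0.9$ over the randomness of the protocol, conditioned on which the output has this distribution. $\tilde{O}(\cdot)$ hides factors polynomial in $\log\frac{n}{\epsilon\delta}$, where $\delta$ is the error probability. -}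

module Defs where

open import Data.Bool.Base using (Bool; T; _∧_)
open import Data.Fin.Base using (Fin; toℕ)
import Data.Fin.Properties as Fin
open import Data.Integer.Base as ℤ using (ℤ; +_; 0ℤ; ∣_∣)
import Data.Integer.Properties as ℤ
open import Data.List.Base using (List; allFin; cartesianProduct; filter; filterᵇ; length)
open import Data.Nat.Base as ℕ using (ℕ; suc; NonZero)
open import Data.Nat.Logarithm using (⌈log₂_⌉)
import Data.Nat.Properties as ℕ
open import Data.Product.Base using (Σ-syntax; _×_; _,_)
open import Data.Product.Properties using (≡-dec)
open import Data.Rational.Base
  using (ℚ; Positive; 1ℚ; _/_; _+_; _-_; _*_; _÷_; _≤_; ceiling)
open import Data.Rational.Properties using (pos⇒nonZero; pos*pos⇒pos)
open import Data.Vec.Base using (Vec)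
open import Data.Vec.Functional using (Vector)
open import Algebra.Properties.Monoid.Sum ℤ.+-0-monoid using (sum-syntax)
open import Relation.Binary.PropositionalEquality.Core using (_≡_; _≢_)
open import Relation.Nullary.Decidable using (⌊_⌋; ¬?)

Matrix : Set → ℕ → Set
Matrix X n = Vector (Vector X n) n

-- The entry set {0,1} is Fin 2; products are computed over ℤ.
_⊗_ : ∀ {n} → Matrix (Fin 2) n → Matrix (Fin 2) n → Matrix ℤ n
_⊗_ {n} A B i j = ∑[ k < n ] (+ toℕ (A i k) ℤ.* + toℕ (B k j))

‖_‖₀ : ∀ {n} → Matrix ℤ n → ℕ
‖_‖₀ {n} C =
  length (filter (λ (i , j) → ¬? (C i j ℤ.≟ 0ℤ)) (cartesianProduct (allFin n) (allFin n)))

-- Deterministic protocols with answers in O.  S is the private view of the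
-- player to move and R that of the other player; the roles swap after every
-- message.  The player to move either outputs the answer or sends b bits.
-- As b depends only on the messages already exchanged, both players know where
-- each message ends, so its length cannot carry uncounted information.
data Protocol (S R O : Set) : Set where
  output : (S → O) → Protocol S R O
  send   : ∀ b → (S → Vec Bool b) → (Vec Bool b → Protocol R S O) → Protocol S R O

answer : ∀ {S R O} → Protocol S R O → S → R → O
answer (output f)   s r = f s
answer (send b m p) s r = answer (p (m s)) r s

bits : ∀ {S R O} → Protocol S R O → S → R → ℕ
bits (output f)   s r = 0
bits (send b m p) s r = b ℕ.+ bits (p (m s)) r s

rounds : ∀ {S R O} → Protocol S R O → S → R → ℕ
rounds (output f)   s r = 0
rounds (send b m p) s r = suc (rounds (p (m s)) r s)

-- Alice (input X) moves first.  Each player's view is the input together with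
-- a private random value, independent of the other's and uniform on a finite
-- nonempty set.
record RandomizedProtocol (X Y O : Set) : Set where
  field
    randA randB       : ℕ
    {{randA-nonZero}} : NonZero randA
    {{randB-nonZero}} : NonZero randB
    protocol          : Protocol (X × Fin randA) (Y × Fin randB) O

  Ω : Set
  Ω = Fin randA × Fin randB

  outputOn : X → Y → Ω → O
  outputOn x y (a , b) = answer protocol (x , a) (y , b)

  bitsOn roundsOn : X → Y → Ω → ℕ
  bitsOn   x y (a , b) = bits   protocol (x , a) (y , b)
  roundsOn x y (a , b) = rounds protocol (x , a) (y , b)

  Event : Set
  Event = Ω → Bool

  #_ : Event → ℕ
  # E = length (filterᵇ E (cartesianProduct (allFin randA) (allFin randB)))

  Pr[_] : Event → ℚ
  Pr[ E ] = (+ # E / (randA ℕ.* randB)) {{ℕ.m*n≢0 randA randB}}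

  Pr[_∣_] : (F E : Event) .{{_ : NonZero (# E)}} → ℚ
  Pr[ F ∣ E ] = + # (λ ω → F ω ∧ E ω) / # E

  CostAtMost : ℚ → Set
  CostAtMost c = ∀ x y ω → + bitsOn x y ω / 1 ≤ c

  HasRounds : ℕ → Set
  HasRounds r = ∀ x y ω → roundsOn x y ω ≡ r

open RandomizedProtocol public

MatrixProtocol : ℕ → Set
MatrixProtocol n = RandomizedProtocol (Matrix (Fin 2) n) (Matrix (Fin 2) n) (Fin n × Fin n)

module _ {n : ℕ} (P : MatrixProtocol n) (A B : Matrix (Fin 2) n) where

  outputs : Fin n → Fin n → Event P
  outputs i j ω = ⌊ ≡-dec Fin._≟_ Fin._≟_ (outputOn P A B ω) (i , j) ⌋

  -- Conditioned on E, the output is a non-zero entry of A ⊗ B, and each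
  -- non-zero entry has probability (1 ± ε) / ‖ A ⊗ B ‖₀.  The first condition
  -- is not implied by the second: the lower bounds only add up to 1 - ε.
  record SamplesGiven (ε : ℚ) .{{_ : NonZero ‖ A ⊗ B ‖₀}}
                      (E : Event P) .{{_ : NonZero (#_ P E)}} : Set where
    field
      nonZeroEntry : ∀ ω → T (E ω) → let (i , j) = outputOn P A B ω in (A ⊗ B) i j ≢ 0ℤ
      lower : ∀ i j → (A ⊗ B) i j ≢ 0ℤ →
              (1ℚ - ε) * (+ 1 / ‖ A ⊗ B ‖₀) ≤ Pr[_∣_] P (outputs i j) E
      upper : ∀ i j → (A ⊗ B) i j ≢ 0ℤ →
              Pr[_∣_] P (outputs i j) E ≤ (1ℚ + ε) * (+ 1 / ‖ A ⊗ B ‖₀)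

-- ℓ₀-sampling with success probability 1 - δ.  Nothing is asked of the output
-- when A ⊗ B = 0, as there is then no entry to sample.  The event E may depend
-- on the input.
ℓ₀-Sampler : ∀ {n} (ε δ : ℚ) → MatrixProtocol n → Set
ℓ₀-Sampler ε δ P = ∀ A B .{{_ : NonZero ‖ A ⊗ B ‖₀}} →
  Σ[ E ∈ Event P ] (1ℚ - δ ≤ Pr[_] P E) ×
  Σ[ E-nonZero ∈ NonZero (#_ P E) ] SamplesGiven P A B ε E {{E-nonZero}}

logFactor : ℕ → (ε δ : ℚ) .{{_ : Positive ε}} .{{_ : Positive δ}} → ℕ
logFactor n ε δ = ⌈log₂ ∣ ceiling (((+ n / 1) ÷ (ε * δ)) {{εδ≢0}}) ∣ ⌉
  where
  εδ≢0 = pos⇒nonZero (ε * δ) {{pos*pos⇒pos ε δ}}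

-- Õ(n / ε²) means at most this for some constants K and k.
n/ε²-bound : (K k n : ℕ) (ε δ : ℚ) .{{_ : Positive ε}} .{{_ : Positive δ}} → ℚ
n/ε²-bound K k n ε δ =
  (+ (K ℕ.* n ℕ.* logFactor n ε δ ℕ.^ k) / 1 ÷ (ε * ε)) {{ε²≢0}}
  where
  ε²≢0 = pos⇒nonZero (ε * ε) {{pos*pos⇒pos ε ε}}

{-# OPTIONS --safe #-}
module Submission where

-- A uniformly random non-zero entry (i , j) of C = A ⊗ B is a column j, chosen with
-- probability |Cⱼ| / ‖C‖₀ where Cⱼ is the set of non-zero rows of column j, and then a
-- uniformly random i in Cⱼ.  Since Cⱼ is the union of those columns of A that B selects,
-- sketches of Cⱼ that survive unions can be assembled by Bob from sketches of the columns
-- of A.  Alice draws two random orders of the rows.  The second one yields i: the first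
-- element of a set under a random order is uniform, and the first element of a union is
-- found among the first elements of its parts.  The first order yields estimates of all
-- |Cⱼ|: Alice sends the places of twelve extreme elements of each column of A, which
-- determine those of every Cⱼ, and if r rows are met before the twelfth element of Cⱼ,
-- then 11 n / r estimates |Cⱼ| without bias and with second moment at most
-- (11/10) |Cⱼ|² (inverse sampling).
--
-- Choosing j proportionally to the estimates w produces every non-zero entry with
-- probability at least 0.9 / ‖C‖₀, by 1 / W ≥ (2 A - W) / A² for W = Σ w and A = E W and
-- by the second moments.  Lower bounds are all that is needed, as the event of success is
-- arbitrary: keeping the same number of outcomes for every non-zero entry makes the
-- conditional distribution exactly uniform.  The cost is O(n log n), independently of ε.

open import Defs
open import Data.Bool.Base using (Bool; true; false; not; _∧_; _∨_; if_then_else_; T)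
import Data.Bool.Properties as Bool
open import Data.Fin.Base using (Fin; zero; suc; toℕ; fromℕ<; _↑ˡ_; _↑ʳ_; combine; remQuot; punchIn; punchOut)
import Data.Fin.Properties as Fin
open import Data.Integer.Base as ℤ using (ℤ; 0ℤ)
import Data.Integer.DivMod as ℤ
import Data.Integer.Properties as ℤ
open import Data.List.Base as List using (List; filter; length; allFin; cartesianProduct)
import Data.List.Properties as List
open import Data.Maybe.Base as Maybe using (Maybe; just; nothing; fromMaybe; maybe′)
open import Data.Nat.Base as ℕ
  using (ℕ; zero; suc; pred; _+_; _*_; _∸_; _^_; _!; _≤_; _≤ᵇ_; _<ᵇ_; _≡ᵇ_; NonZero; z≤n; s≤s)
open import Data.Nat.DivMod
  using (_%_; m<n⇒m%n≡m; [m+kn]%n≡m%n; m/n≤m; m/n*n≡m; m≡m%n+[m/n]*n; m%n<n; m<n*o⇒m/o<n)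
open import Data.Nat.Divisibility using (_∣_; divides; m∣m*n; ∣-trans; m≤n⇒m!∣n!)
open import Data.Nat.Logarithm using (⌈log₂_⌉; ⌈log₂⌉-mono-≤; ⌈log₂2^n⌉≡n)
import Data.Nat.Properties as ℕ
open import Data.Nat.Tactic.RingSolver using (solve-∀)
open import Data.Product.Base using (Σ-syntax; ∃; ∃-syntax; _×_; _,_; proj₁; proj₂; uncurry)
open import Data.Product.Properties using (≡-dec)
open import Data.Rational.Base as ℚ using (ℚ; Positive; NonNegative; 1ℚ; ½; _/_)
import Data.Rational.Properties as ℚ
open import Data.Rational.Unnormalised.Base as ℚᵘ using (mkℚᵘ)
import Data.Rational.Unnormalised.Properties as ℚᵘ
open import Data.Sum.Base using (inj₁; inj₂)
open import Data.Vec.Base using (Vec; lookup; tabulate)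
open import Data.Vec.Functional using (Vector; _∷_; tail; foldr)
open import Data.Vec.Properties using (lookup∘tabulate)
open import Function.Base using (_∘_; id)
open import Function.Bundles using (Equivalence)
open import Relation.Binary.PropositionalEquality
open import Relation.Nullary.Decidable using (Dec; does; isYes≗does; yes; no; ¬?; dec-true; dec-false)
open import Relation.Nullary.Negation using (contradiction)
open import Algebra.Properties.Semiring.Sum ℕ.+-*-semiring
  using (sum; sum-syntax; sum-cong-≗; sum-remove; ∑-distrib-+; ∑-comm; *-distribˡ-sum; *-distribʳ-sum)
import Algebra.Properties.Monoid.Sum ℤ.+-0-monoid as ℤ-Sum

-- Finite sums and cardinalities.

ind : Bool → ℕ
ind b = if b then 1 else 0

card : ∀ {n} → Vector Bool n → ℕ
card f = sum (ind ∘ f)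

sum-const : ∀ n x → ∑[ i < n ] x ≡ n * x
sum-const zero    x = refl
sum-const (suc n) x = cong (x +_) (sum-const n x)

sum-mono : ∀ {n} {f g : Vector ℕ n} → (∀ i → f i ≤ g i) → sum f ≤ sum g
sum-mono {zero}  f≤g = z≤n
sum-mono {suc n} f≤g = ℕ.+-mono-≤ (f≤g zero) (sum-mono (f≤g ∘ suc))

sum-lower : ∀ {n} (f : Vector ℕ n) i → f i ≤ sum f
sum-lower f zero    = ℕ.m≤m+n _ _
sum-lower f (suc i) = ℕ.≤-trans (sum-lower (f ∘ suc) i) (ℕ.m≤n+m _ _)

sum-++ : ∀ m {n} (f : Vector ℕ (m + n)) →
         sum f ≡ ∑[ i < m ] f (i ↑ˡ n) + ∑[ j < n ] f (m ↑ʳ j)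
sum-++ zero    f = refl
sum-++ (suc m) f = trans (cong (f zero +_) (sum-++ m (f ∘ suc))) (sym (ℕ.+-assoc (f zero) _ _))

sum-combine : ∀ m {n} (f : Vector ℕ (m * n)) → sum f ≡ ∑[ i < m ] ∑[ j < n ] f (combine i j)
sum-combine zero        f = refl
sum-combine (suc m) {n} f = trans (sum-++ n f) (cong (∑[ j < n ] f (j ↑ˡ (m * n)) +_) (sum-combine m (f ∘ (n ↑ʳ_))))

sum-remQuot : ∀ m {n} (f : Fin m × Fin n → ℕ) →
              ∑[ x < m * n ] f (remQuot {m} n x) ≡ ∑[ i < m ] ∑[ j < n ] f (i , j)
sum-remQuot m f = trans (sum-combine m _)
  (sum-cong-≗ λ i → sum-cong-≗ λ j → cong f (Fin.remQuot-combine i j))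

card≤n : ∀ {n} (f : Vector Bool n) → card f ≤ n
card≤n {zero}  f = z≤n
card≤n {suc n} f with f zero
... | true  = s≤s (card≤n (f ∘ suc))
... | false = ℕ.m≤n⇒m≤1+n (card≤n (f ∘ suc))

card-not : ∀ {n} (f : Vector Bool n) → card (not ∘ f) + card f ≡ n
card-not {zero}  f = refl
card-not {suc n} f with f zero
... | true  = trans (ℕ.+-suc _ _) (cong suc (card-not (f ∘ suc)))
... | false = cong suc (card-not (f ∘ suc))

-- Random orders.

uncons : ∀ n → Fin (suc n !) → Fin (suc n) × Fin (n !)
uncons n = remQuot (n !)

-- The Lehmer code: an index splits into a first element and an index for an order of the others,
-- which `punchIn` renumbers. A uniform index is thus a uniform order, and inductions over `n` can
-- condition on the first element.
order : ∀ n → Fin (n !) → Vector (Fin n) n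
order (suc n) π = let (u , π′) = uncons n π in u ∷ (punchIn u ∘ order n π′)

sum-order : ∀ n (f : Vector (Fin (suc n)) (suc n) → ℕ) →
  ∑[ π < suc n ! ] f (order (suc n) π) ≡ ∑[ u < suc n ] ∑[ π < n ! ] f (u ∷ (punchIn u ∘ order n π))
sum-order n f = sum-remQuot (suc n) λ (u , π) → f (u ∷ (punchIn u ∘ order n π))

sum-∘order : ∀ n π (f : Vector ℕ n) → sum (f ∘ order n π) ≡ sum f
sum-∘order zero    π f = refl
sum-∘order (suc n) π f = let (u , π′) = uncons n π in
  trans (cong (f u +_) (sum-∘order n π′ (f ∘ punchIn u))) (sym (sum-remove {i = u} f))

card-punchIn : ∀ {n} (C : Vector Bool (suc n)) u → card C ≡ ind (C u) + card (C ∘ punchIn u)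
card-punchIn C u = sum-remove {i = u} (ind ∘ C)

-- Prefixes of a random order and their moments.

-- The length of the longest final segment of f with at most s elements: for prefixes of a
-- random order, index zero stands for the last place.
prefix : ℕ → ∀ {n} → Vector Bool n → ℕ
prefix s {zero}  f = 0
prefix s {suc n} f = if card f ≤ᵇ s then suc n else prefix s (tail f)

≤⇒≤ᵇ≡true : ∀ {m n} → m ≤ n → (m ≤ᵇ n) ≡ true
≤⇒≤ᵇ≡true {m} {n} m≤n with m ≤ᵇ n | ℕ.≤⇒≤ᵇ m≤n
... | true | _ = refl

≰⇒≤ᵇ≡false : ∀ {m n} → n ℕ.< m → (m ≤ᵇ n) ≡ false
≰⇒≤ᵇ≡false {m} {n} n<m with m ≤ᵇ n in eq
... | false = refl
... | true  = contradiction (ℕ.≤ᵇ⇒≤ m n (subst T (sym eq) _)) (ℕ.<⇒≱ n<m)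

prefix-all : ∀ s {n} (f : Vector Bool n) → card f ≤ s → prefix s f ≡ n
prefix-all s {zero}  f c≤s = refl
prefix-all s {suc n} f c≤s = cong (λ b → if b then suc n else prefix s (tail f)) (≤⇒≤ᵇ≡true c≤s)

prefix-tail : ∀ s {n} (f : Vector Bool (suc n)) → s ℕ.< card f → prefix s f ≡ prefix s (tail f)
prefix-tail s {n} f s<c = cong (λ b → if b then suc n else prefix s (tail f)) (≰⇒≤ᵇ≡false s<c)

module _ (s : ℕ) (h : ℕ → ℕ) where

  prefixSum : ∀ {n} → Vector Bool n → ℕ
  prefixSum {n} C = ∑[ π < n ! ] h (prefix s (C ∘ order n π))

  prefixSum-all : ∀ {n} (C : Vector Bool n) → card C ≤ s → prefixSum C ≡ n ! * h n
  prefixSum-all {n} C c≤s = trans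
    (sum-cong-≗ λ π → cong h (prefix-all s (C ∘ order n π)
      (ℕ.≤-trans (ℕ.≤-reflexive (sum-∘order n π (ind ∘ C))) c≤s)))
    (sum-const (n !) (h n))

  -- A set with more than `s` elements does not fit into the segment, so the first place is dropped,
  -- and a random order of the other points remains.
  prefixSum-rec : ∀ {n} (C : Vector Bool (suc n)) → s ℕ.< card C →
                  prefixSum C ≡ ∑[ u < suc n ] prefixSum (C ∘ punchIn u)
  prefixSum-rec {n} C s<c = trans
    (sum-cong-≗ λ π → cong h (prefix-tail s (C ∘ order (suc n) π)
      (ℕ.≤-trans s<c (ℕ.≤-reflexive (sym (sum-∘order (suc n) π (ind ∘ C)))))))
    (sum-order n λ σ → h (prefix s (C ∘ tail σ)))

card-punchIn-≥ : ∀ {n s} (C : Vector Bool (suc n)) u → s ℕ.< card C → s ≤ card (C ∘ punchIn u)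
card-punchIn-≥ C u s<c with C u | card-punchIn C u
... | true  | eq = ℕ.≤-pred (ℕ.≤-trans s<c (ℕ.≤-reflexive eq))
... | false | eq = ℕ.<⇒≤ (ℕ.≤-trans s<c (ℕ.≤-reflexive eq))

-- Double counting: an element of `C` survives the removal of each of the `n` other points.
sum-card-punchIn : ∀ {n} (C : Vector Bool (suc n)) → ∑[ u < suc n ] card (C ∘ punchIn u) ≡ n * card C
sum-card-punchIn {n} C = ℕ.+-cancelˡ-≡ (card C) _ _ (begin
  card C + ∑[ u < suc n ] card (C ∘ punchIn u)     ≡⟨ ∑-distrib-+ (ind ∘ C) (λ u → card (C ∘ punchIn u)) ⟨
  ∑[ u < suc n ] (ind (C u) + card (C ∘ punchIn u)) ≡⟨ sum-cong-≗ (λ u → card-punchIn C u) ⟨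
  ∑[ u < suc n ] card C                            ≡⟨ sum-const (suc n) (card C) ⟩
  card C + n * card C                              ∎)
  where open ≡-Reasoning

-- The number of ordered pairs of distinct elements in a set of size `x`.
fall : ℕ → ℕ
fall x = x * pred x

-- Removing an element `u` of `C` destroys the ordered pairs that contain it: `pred (card C)` with
-- `u` on the left and as many with `u` on the right.
fall-punchIn : ∀ {n} (C : Vector Bool (suc n)) u →
               2 * pred (card C) * ind (C u) + fall (card (C ∘ punchIn u)) ≡ fall (card C)
fall-punchIn C u with C u | card C | card-punchIn C u
... | true  | _ | refl = lemma (card (C ∘ punchIn u))
  where
  lemma⁺ : ∀ c → 2 * suc c * 1 + suc c * c ≡ suc c + suc c * suc c
  lemma⁺ = solve-∀
  lemma : ∀ c → 2 * c * 1 + c * pred c ≡ c + c * c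
  lemma zero    = refl
  lemma (suc c) = lemma⁺ c
... | false | _ | refl = cong (_+ fall (card (C ∘ punchIn u))) (ℕ.*-zeroʳ (2 * pred (card (C ∘ punchIn u))))

-- Double counting again: a pair survives the removal of all but two of the `suc n` points.
sum-fall-punchIn : ∀ {n} (C : Vector Bool (suc n)) →
  ∑[ u < suc n ] fall (card (C ∘ punchIn u)) ≡ pred n * fall (card C)
sum-fall-punchIn {zero} C = cong (λ c → fall c + 0) (ℕ.n≤0⇒n≡0 (card≤n (C ∘ punchIn zero)))
sum-fall-punchIn {suc m} C = ℕ.+-cancelˡ-≡ (2 * pred (card C) * card C) _ _ (begin
  2 * pred (card C) * card C + sum (λ u → fall (card (C ∘ punchIn u)))
    ≡⟨ cong (_+ sum (λ u → fall (card (C ∘ punchIn u)))) (*-distribˡ-sum (2 * pred (card C)) (ind ∘ C)) ⟩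
  ∑[ u < suc (suc m) ] (2 * pred (card C) * ind (C u)) + sum (λ u → fall (card (C ∘ punchIn u)))
    ≡⟨ ∑-distrib-+ (λ u → 2 * pred (card C) * ind (C u)) (λ u → fall (card (C ∘ punchIn u))) ⟨
  ∑[ u < suc (suc m) ] (2 * pred (card C) * ind (C u) + fall (card (C ∘ punchIn u)))
    ≡⟨ sum-cong-≗ (fall-punchIn C) ⟩
  ∑[ u < suc (suc m) ] fall (card C)
    ≡⟨ sum-const (suc (suc m)) (fall (card C)) ⟩
  suc (suc m) * (card C * pred (card C))
    ≡⟨ lemma m (card C) (pred (card C)) ⟩
  2 * pred (card C) * card C + m * (card C * pred (card C)) ∎)
  where
  open ≡-Reasoning
  lemma : ∀ m c p → suc (suc m) * (c * p) ≡ 2 * p * c + m * (c * p)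
  lemma = solve-∀

-- The prefix length r of a random order has E[s / r] = card C / n and
-- E[s (s - 1) / r²] ≤ card C (card C - 1) / (n (n - 1)).
module _ (s₀ G : ℕ) (g : ℕ → ℕ) where

  private
    s : ℕ
    s = suc (suc s₀)

  -- Here `g r` stands for G / r, which stays a natural number when `G` is a common multiple of all
  -- prefix lengths.
  InvertsUpTo : ℕ → Set
  InvertsUpTo n = ∀ {r} → r ℕ.< n → g (suc r) * suc r ≡ G

  private
    shrink : ∀ {n} → InvertsUpTo (suc n) → InvertsUpTo n
    shrink inv r<n = inv (ℕ.m<n⇒m<1+n r<n)

    s≤n : ∀ {n} (C : Vector Bool (suc n)) → s ℕ.< card C → s ≤ n
    s≤n C s<c = ℕ.≤-pred (ℕ.≤-trans s<c (card≤n C))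

  prefix-moment₁ : ∀ {n} → InvertsUpTo n → (C : Vector Bool n) → s ≤ card C →
                   s * n * prefixSum s g C ≡ n ! * card C * G
  prefix-moment₁ {zero}  inv C ()
  prefix-moment₁ {suc n} inv C s≤c with card C ℕ.≤? s
  -- Now `card C` is `s`, so the segment is everything and has length `suc n` in every order.
  ... | yes c≤s rewrite prefixSum-all s g C c≤s | ℕ.≤-antisym c≤s s≤c | sym (inv (ℕ.n<1+n n)) =
    lemma s (suc n) (suc n !) (g (suc n))
    where
    lemma : ∀ s m p x → s * m * (p * x) ≡ p * s * (x * m)
    lemma = solve-∀
  -- Dropping a random point preserves the density of `C` on average, by `sum-card-punchIn`.
  ... | no c≰s = ℕ.*-cancelˡ-≡ _ _ n {{ℕ.>-nonZero (ℕ.≤-trans (s≤s z≤n) (s≤n C (ℕ.≰⇒> c≰s)))}} (begin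
    n * (s * suc n * prefixSum s g C)                ≡⟨ cong (λ x → n * (s * suc n * x)) (prefixSum-rec s g C (ℕ.≰⇒> c≰s)) ⟩
    n * (s * suc n * ∑[ u < suc n ] prefixSum s g (C ∘ punchIn u)) ≡⟨ lemma₁ n s _ ⟩
    suc n * (s * n * ∑[ u < suc n ] prefixSum s g (C ∘ punchIn u)) ≡⟨ cong (suc n *_) (*-distribˡ-sum (s * n) (λ u → prefixSum s g (C ∘ punchIn u))) ⟩
    suc n * ∑[ u < suc n ] (s * n * prefixSum s g (C ∘ punchIn u)) ≡⟨ cong (suc n *_) (sum-cong-≗ λ u → prefix-moment₁ (shrink inv) (C ∘ punchIn u) (card-punchIn-≥ C u (ℕ.≰⇒> c≰s))) ⟩
    suc n * ∑[ u < suc n ] (n ! * card (C ∘ punchIn u) * G) ≡⟨ cong (suc n *_) (*-distribʳ-sum G (λ u → n ! * card (C ∘ punchIn u))) ⟨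
    suc n * (∑[ u < suc n ] (n ! * card (C ∘ punchIn u)) * G) ≡⟨ cong (λ x → suc n * (x * G)) (*-distribˡ-sum (n !) (λ u → card (C ∘ punchIn u))) ⟨
    suc n * (n ! * ∑[ u < suc n ] card (C ∘ punchIn u) * G) ≡⟨ cong (λ x → suc n * (n ! * x * G)) (sum-card-punchIn C) ⟩
    suc n * (n ! * (n * card C) * G)                 ≡⟨ lemma₂ n (n !) (card C) G ⟩
    n * (suc n ! * card C * G)                       ∎)
    where
    open ≡-Reasoning
    lemma₁ : ∀ n s x → n * (s * suc n * x) ≡ suc n * (s * n * x)
    lemma₁ = solve-∀
    lemma₂ : ∀ n p c G → suc n * (p * (n * c) * G) ≡ n * (suc n * p * c * G)
    lemma₂ = solve-∀

  prefix-moment₂ : ∀ {n} → InvertsUpTo n → (C : Vector Bool n) → s ≤ card C →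
                   fall s * fall n * prefixSum s (λ r → g r * g r) C ≤ n ! * fall (card C) * (G * G)
  prefix-moment₂ {zero}  inv C ()
  prefix-moment₂ {suc n} inv C s≤c with card C ℕ.≤? s
  -- Equality is lost only here: `g` is inverted by `suc n * suc n`, whereas the left side has
  -- `suc n * n`.
  ... | yes c≤s rewrite prefixSum-all s (λ r → g r * g r) C c≤s | ℕ.≤-antisym c≤s s≤c | sym (inv (ℕ.n<1+n n)) =
    begin
      fall s * (suc n * n) * (suc n ! * (x * x))       ≤⟨ ℕ.*-monoˡ-≤ _ (ℕ.*-monoʳ-≤ (fall s) (ℕ.*-monoʳ-≤ (suc n) (ℕ.n≤1+n n))) ⟩
      fall s * (suc n * suc n) * (suc n ! * (x * x))   ≡⟨ lemma (fall s) (suc n) (suc n !) x ⟩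
      suc n ! * fall s * (x * suc n * (x * suc n))     ∎
    where
    open ℕ.≤-Reasoning
    x = g (suc n)
    lemma : ∀ f m p x → f * (m * m) * (p * (x * x)) ≡ p * f * (x * m * (x * m))
    lemma = solve-∀
  -- The density of pairs, `fall (card C)` over `fall n`, is likewise preserved on average.
  ... | no c≰s = ℕ.*-cancelˡ-≤ (pred n) {{ℕ.>-nonZero (ℕ.≤-trans (s≤s z≤n) (ℕ.pred-mono-≤ (s≤n C s<c)))}} (begin
      pred n * (fall s * (suc n * n) * prefixSum s g² C)
        ≡⟨ cong (λ x → pred n * (fall s * (suc n * n) * x)) (prefixSum-rec s g² C s<c) ⟩
      pred n * (fall s * (suc n * n) * ∑[ u < suc n ] Q u)
        ≡⟨ lemma₁ n (pred n) (fall s) _ ⟩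
      suc n * (fall s * fall n * ∑[ u < suc n ] Q u)
        ≡⟨ cong (suc n *_) (*-distribˡ-sum (fall s * fall n) Q) ⟩
      suc n * ∑[ u < suc n ] (fall s * fall n * Q u)
        ≤⟨ ℕ.*-monoʳ-≤ (suc n) (sum-mono λ u → prefix-moment₂ (shrink inv) (C ∘ punchIn u) (card-punchIn-≥ C u s<c)) ⟩
      suc n * ∑[ u < suc n ] (n ! * F u * (G * G))
        ≡⟨ cong (suc n *_) (*-distribʳ-sum (G * G) (λ u → n ! * F u)) ⟨
      suc n * (∑[ u < suc n ] (n ! * F u) * (G * G))
        ≡⟨ cong (λ x → suc n * (x * (G * G))) (*-distribˡ-sum (n !) F) ⟨
      suc n * (n ! * ∑[ u < suc n ] F u * (G * G))
        ≡⟨ cong (λ x → suc n * (n ! * x * (G * G))) (sum-fall-punchIn C) ⟩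
      suc n * (n ! * (pred n * fall (card C)) * (G * G))
        ≡⟨ lemma₂ n (pred n) (n !) (fall (card C)) (G * G) ⟩
      pred n * (suc n ! * fall (card C) * (G * G)) ∎)
    where
    open ℕ.≤-Reasoning
    s<c = ℕ.≰⇒> c≰s
    g² : ℕ → ℕ
    g² r = g r * g r
    Q F : Fin (suc n) → ℕ
    Q u = prefixSum s g² (C ∘ punchIn u)
    F u = fall (card (C ∘ punchIn u))
    lemma₁ : ∀ n p f x → p * (f * (suc n * n) * x) ≡ suc n * (f * (n * p) * x)
    lemma₁ = solve-∀
    lemma₂ : ∀ n p q f H → suc n * (q * (p * f) * H) ≡ p * (suc n * q * f * H)
    lemma₂ = solve-∀

-- The first element of a set in a random order.

_is_ : ∀ {n} → Maybe (Fin n) → Fin n → Bool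
nothing is i = false
just x  is i = does (x Fin.≟ i)

is-map : ∀ {m n} (h : Fin m → Fin n) → (∀ {x y} → h x ≡ h y → x ≡ y) →
         ∀ x i → (Maybe.map h x is h i) ≡ (x is i)
is-map h inj nothing  i = refl
is-map h inj (just x) i with x Fin.≟ i
... | yes x≡i = dec-true  (h x Fin.≟ h i) (cong h x≡i)
... | no  x≢i = dec-false (h x Fin.≟ h i) (x≢i ∘ inj)

sum-≟ : ∀ {n} (i : Fin n) → ∑[ u < n ] ind (does (u Fin.≟ i)) ≡ 1
sum-≟ {suc n} zero    = cong suc (trans (sum-cong-≗ {n} λ u → refl) (trans (sum-const n 0) (ℕ.*-zeroʳ n)))
sum-≟ {suc n} (suc i) = trans (sum-cong-≗ λ u → cong ind (≟-suc u)) (sum-≟ i)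
  where
  ≟-suc : ∀ u → does (suc u Fin.≟ suc i) ≡ does (u Fin.≟ i)
  ≟-suc u with u Fin.≟ i
  ... | yes _ = refl
  ... | no  _ = refl

find : ∀ {A : Set} {n} → Vector Bool n → Vector A n → Maybe A
find {n = zero}  f v = nothing
find {n = suc n} f v = if f zero then just (v zero) else find (tail f) (tail v)

find-map : ∀ {A B : Set} {n} (h : A → B) (f : Vector Bool n) (v : Vector A n) →
           find f (h ∘ v) ≡ Maybe.map h (find f v)
find-map {n = zero}  h f v = refl
find-map {n = suc n} h f v with f zero
... | true  = refl
... | false = find-map h (tail f) (tail v)

firstIn : ∀ {n} → Vector Bool n → Vector (Fin n) n → Maybe (Fin n)
firstIn C σ = find (C ∘ σ) σ

-- Condition on the first point `u`. If `u` lies in `C`, then it leads, and it is `i` for a single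
-- `u`. Otherwise `i` leads the remaining order in one of `card C` cases, by induction. The
-- contributions add up to `n !` times the number of points outside `C` plus `card C`.
count-firstIn : ∀ n (C : Vector Bool n) i → C i ≡ true →
  card C * ∑[ π < n ! ] ind (firstIn C (order n π) is i) ≡ n !
count-firstIn (suc n) C i Ci = begin
  card C * ∑[ π < suc n ! ] ind (firstIn C (order (suc n) π) is i)
    ≡⟨ cong (card C *_) (sum-order n λ σ → ind (firstIn C σ is i)) ⟩
  card C * ∑[ u < suc n ] V u
    ≡⟨ *-distribˡ-sum (card C) V ⟩
  ∑[ u < suc n ] (card C * V u)
    ≡⟨ sum-cong-≗ V-value ⟩
  ∑[ u < suc n ] (n ! * (ind (not (C u)) + card C * ind (does (u Fin.≟ i))))
    ≡⟨ *-distribˡ-sum (n !) (λ u → ind (not (C u)) + card C * ind (does (u Fin.≟ i))) ⟨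
  n ! * ∑[ u < suc n ] (ind (not (C u)) + card C * ind (does (u Fin.≟ i)))
    ≡⟨ cong (n ! *_) (∑-distrib-+ (ind ∘ not ∘ C) (λ u → card C * ind (does (u Fin.≟ i)))) ⟩
  n ! * (card (not ∘ C) + ∑[ u < suc n ] (card C * ind (does (u Fin.≟ i))))
    ≡⟨ cong (λ x → n ! * (card (not ∘ C) + x)) (*-distribˡ-sum (card C) (λ u → ind (does (u Fin.≟ i)))) ⟨
  n ! * (card (not ∘ C) + card C * ∑[ u < suc n ] ind (does (u Fin.≟ i)))
    ≡⟨ cong (λ x → n ! * (card (not ∘ C) + card C * x)) (sum-≟ i) ⟩
  n ! * (card (not ∘ C) + card C * 1)
    ≡⟨ cong (λ x → n ! * (card (not ∘ C) + x)) (ℕ.*-identityʳ (card C)) ⟩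
  n ! * (card (not ∘ C) + card C)
    ≡⟨ cong (n ! *_) (card-not C) ⟩
  n ! * suc n
    ≡⟨ ℕ.*-comm (n !) (suc n) ⟩
  suc n ! ∎
  where
  open ≡-Reasoning
  V : Fin (suc n) → ℕ
  V u = ∑[ π < n ! ] ind (firstIn C (u ∷ (punchIn u ∘ order n π)) is i)
  V-value : ∀ u → card C * V u ≡ n ! * (ind (not (C u)) + card C * ind (does (u Fin.≟ i)))
  V-value u with C u in Cu
  ... | true  = trans (cong (card C *_) (sum-const (n !) _)) (lemma (card C) (n !) _)
    where
    lemma : ∀ c p x → c * (p * x) ≡ p * (c * x)
    lemma = solve-∀
  ... | false with u Fin.≟ i
  ... | yes refl = contradiction (trans (sym Cu) Ci) λ ()
  ... | no  u≢i  = begin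
    card C * ∑[ π < n ! ] ind (find (C ∘ punchIn u ∘ order n π) (punchIn u ∘ order n π) is i)
      ≡⟨ cong₂ _*_ (trans (card-punchIn C u) (cong (λ b → ind b + card (C ∘ punchIn u)) Cu))
                   (sum-cong-≗ λ π → cong ind (first-punchIn π)) ⟩
    card (C ∘ punchIn u) * ∑[ π < n ! ] ind (firstIn (C ∘ punchIn u) (order n π) is punchOut u≢i)
      ≡⟨ count-firstIn n (C ∘ punchIn u) (punchOut u≢i) (trans (cong C (Fin.punchIn-punchOut u≢i)) Ci) ⟩
    n !
      ≡⟨ lemma (n !) (card C) ⟩
    n ! * (1 + card C * 0) ∎
    where
    lemma : ∀ p c → p ≡ p * (1 + c * 0)
    lemma = solve-∀
    first-punchIn : ∀ π → (find (C ∘ punchIn u ∘ order n π) (punchIn u ∘ order n π) is i)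
                        ≡ (firstIn (C ∘ punchIn u) (order n π) is punchOut u≢i)
    first-punchIn π = trans
      (cong₂ _is_ (find-map (punchIn u) (C ∘ punchIn u ∘ order n π) (order n π)) (sym (Fin.punchIn-punchOut u≢i)))
      (is-map (punchIn u) (λ {x} {y} → Fin.punchIn-injective u x y) (firstIn (C ∘ punchIn u) (order n π)) (punchOut u≢i))

-- Choosing an index with given weights.

select : ∀ {n} → Vector ℕ n → ℕ → Maybe (Fin n)
select {zero}  w y = nothing
select {suc n} w y = if y <ᵇ w zero then just zero else Maybe.map suc (select (tail w) (y ∸ w zero))

<⇒<ᵇ≡true : ∀ {m n} → m ℕ.< n → (m <ᵇ n) ≡ true
<⇒<ᵇ≡true {m} {n} m<n with m <ᵇ n | ℕ.<⇒<ᵇ m<n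
... | true | _ = refl

≮⇒<ᵇ≡false : ∀ {m n} → n ≤ m → (m <ᵇ n) ≡ false
≮⇒<ᵇ≡false {m} {n} n≤m with m <ᵇ n in eq
... | false = refl
... | true  = contradiction (ℕ.<ᵇ⇒< m n (subst T (sym eq) _)) (ℕ.≤⇒≯ n≤m)

-- Consecutive intervals of lengths `w j` tile the numbers below `sum w`, and `select` finds the
-- interval that contains `y`.
count-select : ∀ {n} (w : Vector ℕ n) j → ∑[ y < sum w ] ind (select w (toℕ y) is j) ≡ w j
count-select {suc n} w j = trans (sum-++ w₀ (λ y → ind (select w (toℕ y) is j)))
  (trans (cong₂ _+_ (sum-cong-≗ {w₀} low) (sum-cong-≗ {sum (tail w)} high)) (by-index j))
  where
  w₀ = w zero
  low : ∀ y → ind (select w (toℕ (y ↑ˡ sum (tail w))) is j) ≡ ind (does (zero Fin.≟ j))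
  low y rewrite <⇒<ᵇ≡true (subst (ℕ._< w₀) (sym (Fin.toℕ-↑ˡ y (sum (tail w)))) (Fin.toℕ<n y)) = refl
  high : ∀ y → ind (select w (toℕ (w₀ ↑ʳ y)) is j) ≡ ind (Maybe.map suc (select (tail w) (toℕ y)) is j)
  high y rewrite Fin.toℕ-↑ʳ w₀ y | ≮⇒<ᵇ≡false (ℕ.m≤m+n w₀ (toℕ y)) | ℕ.m+n∸m≡n w₀ (toℕ y) = refl
  by-index : ∀ j → ∑[ y < w₀ ] ind (does (zero Fin.≟ j)) +
                   ∑[ y < sum (tail w) ] ind (Maybe.map suc (select (tail w) (toℕ y)) is j) ≡ w j
  by-index zero = trans (cong₂ _+_ (trans (sum-const w₀ 1) (ℕ.*-identityʳ w₀))
    (trans (sum-cong-≗ {sum (tail w)} λ y → cong ind (never (select (tail w) (toℕ y))))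
      (trans (sum-const (sum (tail w)) 0) (ℕ.*-zeroʳ (sum (tail w)))))) (ℕ.+-identityʳ w₀)
    where
    never : ∀ x → (Maybe.map suc x is zero) ≡ false
    never nothing  = refl
    never (just x) = refl
  by-index (suc j) = cong₂ _+_ (trans (sum-const w₀ 0) (ℕ.*-zeroʳ w₀))
    (trans (sum-cong-≗ {sum (tail w)} λ y → cong ind (is-map suc Fin.suc-injective (select (tail w) (toℕ y)) j))
           (count-select (tail w) j))

choose : ∀ {n} → Vector ℕ n → ℕ → Maybe (Fin n)
choose w b with sum w
... | zero      = nothing
... | W@(suc _) = select w (b % W)

sum-% : ∀ q W .{{_ : NonZero W}} (F : ℕ → ℕ) →
        ∑[ b < q * W ] F (toℕ b % W) ≡ q * ∑[ y < W ] F (toℕ y)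
sum-% q W F = trans (sum-combine q (λ b → F (toℕ b % W)))
  (trans (sum-cong-≗ λ x → sum-cong-≗ λ y → cong F (rem x y)) (sum-const q (∑[ y < W ] F (toℕ y))))
  where
  rem : ∀ (x : Fin q) (y : Fin W) → toℕ (combine x y) % W ≡ toℕ y
  rem x y = begin
    toℕ (combine x y) % W      ≡⟨ cong (_% W) (Fin.toℕ-combine x y) ⟩
    (W * toℕ x + toℕ y) % W    ≡⟨ cong (_% W) (trans (ℕ.+-comm (W * toℕ x) (toℕ y)) (cong (toℕ y +_) (ℕ.*-comm W (toℕ x)))) ⟩
    (toℕ y + toℕ x * W) % W    ≡⟨ [m+kn]%n≡m%n (toℕ y) (toℕ x) W ⟩
    toℕ y % W                  ≡⟨ m<n⇒m%n≡m (Fin.toℕ<n y) ⟩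
    toℕ y                      ∎
    where open ≡-Reasoning

-- As the total weight divides `R`, the numbers below `R` take every residue equally often, so
-- reduction introduces no bias.
count-choose : ∀ {n} (w : Vector ℕ n) j R → 0 ℕ.< sum w → sum w ∣ R →
               sum w * ∑[ b < R ] ind (choose w (toℕ b) is j) ≡ R * w j
count-choose w j R 0<W W∣R with sum w in eq | W∣R
... | W@(suc _) | divides q refl = begin
  W * ∑[ b < q * W ] ind (select w (toℕ b % W) is j)  ≡⟨ cong (W *_) (sum-% q W (λ y → ind (select w y is j))) ⟩
  W * (q * ∑[ y < W ] ind (select w (toℕ y) is j))    ≡⟨ cong (λ x → W * (q * x)) (subst (λ W → ∑[ y < W ] ind (select w (toℕ y) is j) ≡ w j) eq (count-select w j)) ⟩
  W * (q * w j)                                       ≡⟨ trans (sym (ℕ.*-assoc W q (w j))) (cong (_* w j) (ℕ.*-comm W q)) ⟩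
  q * W * w j                                         ∎
  where open ≡-Reasoning

-- Congruences, disjunctions and inclusions.

select-cong : ∀ {n} {w w′ : Vector ℕ n} → w ≗ w′ → select w ≗ select w′
select-cong {zero}  w≗w′ y = refl
select-cong {suc n} {w} {w′} w≗w′ y rewrite w≗w′ zero | select-cong (w≗w′ ∘ suc) (y ∸ w′ zero) = refl

choose-cong : ∀ {n} {w w′ : Vector ℕ n} → w ≗ w′ → choose w ≗ choose w′
choose-cong {w = w} {w′} w≗w′ b with sum w | sum w′ | sum-cong-≗ w≗w′
... | zero    | _ | refl = refl
... | W@(suc _) | _ | refl = select-cong w≗w′ (b % W)

find-cong : ∀ {A : Set} {n} (f : Vector Bool n) {v v′ : Vector A n} → v ≗ v′ → find f v ≡ find f v′
find-cong {n = zero}  f v≗v′ = refl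
find-cong {n = suc n} f v≗v′ with f zero
... | true  = cong just (v≗v′ zero)
... | false = find-cong (tail f) (v≗v′ ∘ suc)

is-sound : ∀ {n} (x : Maybe (Fin n)) i → (x is i) ≡ true → x ≡ just i
is-sound (just x) i p with x Fin.≟ i
... | yes x≡i = cong just x≡i

or : ∀ {n} → Vector Bool n → Bool
or = foldr _∨_ false

or-intro : ∀ {n} (f : Vector Bool n) i → f i ≡ true → or f ≡ true
or-intro f zero    fi = cong (_∨ or (tail f)) fi
or-intro f (suc i) fi = trans (cong (f zero ∨_) (or-intro (tail f) i fi)) (Bool.∨-zeroʳ (f zero))

or-elim : ∀ {n} (f : Vector Bool n) → or f ≡ true → ∃ λ i → f i ≡ true
or-elim {suc n} f p with f zero in eq
... | true  = zero , eq
... | false = let (i , fi) = or-elim (tail f) p in suc i , fi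

∧-intro : ∀ {a b} → a ≡ true → b ≡ true → a ∧ b ≡ true
∧-intro refl refl = refl

∧-elim : ∀ {a b} → a ∧ b ≡ true → a ≡ true × b ≡ true
∧-elim {true} p = refl , p

≡ᵇ-intro : ∀ {m n} → m ≡ n → (m ≡ᵇ n) ≡ true
≡ᵇ-intro {m} refl with m ≡ᵇ m | ℕ.≡⇒≡ᵇ m m refl
... | true | _ = refl

≡ᵇ-elim : ∀ {m n} → (m ≡ᵇ n) ≡ true → m ≡ n
≡ᵇ-elim {m} {n} p = ℕ.≡ᵇ⇒≡ m n (subst T (sym p) _)

_⊆_ : ∀ {n} → Vector Bool n → Vector Bool n → Set
f ⊆ g = ∀ i → f i ≡ true → g i ≡ true

ind-mono : ∀ a b → (a ≡ true → b ≡ true) → ind a ≤ ind b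
ind-mono true  b p rewrite p refl = s≤s z≤n
ind-mono false b p = z≤n

card-mono : ∀ {n} {f g : Vector Bool n} → f ⊆ g → card f ≤ card g
card-mono {f = f} {g} f⊆g = sum-mono λ i → ind-mono (f i) (g i) (f⊆g i)

card-member : ∀ {n} (f : Vector Bool n) i → f i ≡ true → 1 ≤ card f
card-member f i fi = ℕ.≤-trans (ℕ.≤-reflexive (cong ind (sym fi))) (sum-lower (ind ∘ f) i)

card-tail : ∀ {n} (f : Vector Bool (suc n)) → card (tail f) ≤ card f
card-tail f = ℕ.m≤n+m (card (tail f)) (ind (f zero))

-- Sketches of sets that survive unions.

after : ∀ {n} → Vector Bool n → Fin n → ℕ
after f zero    = card (tail f)
after f (suc i) = after (tail f) i

after≤card : ∀ {n} (f : Vector Bool n) i → after f i ≤ card f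
after≤card f zero    = card-tail f
after≤card f (suc i) = ℕ.≤-trans (after≤card (tail f) i) (card-tail f)

after<card : ∀ {n} (f : Vector Bool n) i → f i ≡ true → after f i ℕ.< card f
after<card f zero    fi = ℕ.≤-reflexive (cong (λ b → ind b + card (tail f)) (sym fi))
after<card f (suc i) fi = ℕ.≤-trans (after<card (tail f) i fi) (card-tail f)

after-mono : ∀ {n} {f g : Vector Bool n} → f ⊆ g → ∀ i → after f i ≤ after g i
after-mono f⊆g zero    = card-mono (f⊆g ∘ suc)
after-mono f⊆g (suc i) = after-mono (f⊆g ∘ suc) i

-- One more than the place of the element that is followed by exactly `x` others; the shift leaves 0
-- for sets with at most `x` elements.
drops : ℕ → ∀ {n} → Vector Bool n → ℕ
drops x {zero}  f = 0
drops x {suc n} f = if card f ≤ᵇ x then 0 else suc (drops x (tail f))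

drops≤n : ∀ x {n} (f : Vector Bool n) → drops x f ≤ n
drops≤n x {zero}  f = z≤n
drops≤n x {suc n} f with card f ≤ᵇ x
... | true  = z≤n
... | false = s≤s (drops≤n x (tail f))

drops-after : ∀ {n} (f : Vector Bool n) i → f i ≡ true → drops (after f i) f ≡ suc (toℕ i)
drops-after {suc n} f i fi rewrite ≰⇒≤ᵇ≡false (after<card f i fi) = cong suc (rest i fi)
  where
  rest : ∀ i → f i ≡ true → drops (after f i) (tail f) ≡ toℕ i
  rest (suc i) fi = drops-after (tail f) i fi
  rest zero    fi = none (tail f)
    where
    none : ∀ {n} (g : Vector Bool n) → drops (card g) g ≡ 0
    none {zero}  g = refl
    none {suc n} g rewrite ≤⇒≤ᵇ≡true (ℕ.≤-refl {card g}) = refl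

drops≡0 : ∀ x {n} (f : Vector Bool n) → drops x f ≡ 0 → card f ≤ x
drops≡0 x {zero}  f p = z≤n
drops≡0 x {suc n} f p with card f ≤ᵇ x in eq
... | true = ℕ.≤ᵇ⇒≤ (card f) x (subst T (sym eq) _)

-- Dropping the last of these places brings the count from above `x` to at most `x`, so that place
-- holds an element.
drops-member : ∀ x {n} (f : Vector Bool n) i → drops x f ≡ suc (toℕ i) → f i ≡ true
drops-member x {suc n} f i p with card f ℕ.≤? x
... | yes c≤x rewrite ≤⇒≤ᵇ≡true c≤x = contradiction p λ ()
drops-member x {suc n} f (suc i) p | no c≰x rewrite ≰⇒≤ᵇ≡false (ℕ.≰⇒> c≰x) = drops-member x (tail f) i (ℕ.suc-injective p)
drops-member x {suc n} f zero    p | no c≰x rewrite ≰⇒≤ᵇ≡false (ℕ.≰⇒> c≰x) with f zero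
... | true  = refl
... | false = contradiction (drops≡0 x (tail f) (ℕ.suc-injective p)) c≰x

-- U is a subset of V that contains the last s + 1 elements of V.
_≈⟨_⟩_ : ∀ {n} → Vector Bool n → ℕ → Vector Bool n → Set
U ≈⟨ s ⟩ V = U ⊆ V × (∀ i → V i ≡ true → after V i ≤ s → U i ≡ true)

≈-tail : ∀ {n s} {U V : Vector Bool (suc n)} → U ≈⟨ s ⟩ V → tail U ≈⟨ s ⟩ tail V
≈-tail (U⊆V , keep) = U⊆V ∘ suc , keep ∘ suc

≈-card-≤ : ∀ {n s} {U V : Vector Bool n} → U ≈⟨ s ⟩ V → card V ≤ s → card U ≡ card V
≈-card-≤ {V = V} (U⊆V , keep) c≤s =
  ℕ.≤-antisym (card-mono U⊆V) (card-mono λ i Vi → keep i Vi (ℕ.≤-trans (after≤card V i) c≤s))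

-- At the place where the count of `V` falls to `s`, the element has `s` successors, so `U` contains
-- it along with all of them.
≈-card-> : ∀ {n s} {U V : Vector Bool n} → U ≈⟨ s ⟩ V → s ℕ.< card V → s ℕ.< card U
≈-card-> {suc n} {s} {U} {V} U≈V@(U⊆V , keep) s<c with card (tail V) ℕ.≤? s
... | no  c≰s = ℕ.≤-trans (≈-card-> (≈-tail {U = U} {V} U≈V) (ℕ.≰⇒> c≰s)) (card-tail U)
... | yes c≤s with V zero in V₀
... | false = contradiction c≤s (ℕ.<⇒≱ s<c)
... | true  = subst (s ℕ.<_) (sym (cong₂ _+_ (cong ind (keep zero V₀ c≤s)) (≈-card-≤ (≈-tail {U = U} {V} U≈V) c≤s))) s<c

-- The test against `s` has the same result for `U` and `V` at every tail. Keeping one element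
-- beyond `s` is what makes an excess over `s` visible in `U`.
prefix-≈ : ∀ {n s} {U V : Vector Bool n} → U ≈⟨ s ⟩ V → prefix s U ≡ prefix s V
prefix-≈ {zero}  U≈V = refl
prefix-≈ {suc n} {s} {U} {V} U≈V with card V ℕ.≤? s
... | yes c≤s rewrite ≈-card-≤ U≈V c≤s | ≤⇒≤ᵇ≡true c≤s = refl
... | no  c≰s rewrite ≰⇒≤ᵇ≡false (ℕ.≰⇒> c≰s) | ≰⇒≤ᵇ≡false (≈-card-> U≈V (ℕ.≰⇒> c≰s)) =
  prefix-≈ {U = tail U} {V = tail V} (≈-tail {U = U} {V} U≈V)

-- The value `n`, which is no place, marks the empty set.
first : ∀ {n} → Vector Bool n → ℕ
first {zero}  f = 0
first {suc n} f = if f zero then 0 else suc (first (tail f))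

first≤n : ∀ {n} (f : Vector Bool n) → first f ≤ n
first≤n {zero}  f = z≤n
first≤n {suc n} f with f zero
... | true  = z≤n
... | false = s≤s (first≤n (tail f))

first-≤ : ∀ {n} (f : Vector Bool n) i → f i ≡ true → first f ≤ toℕ i
first-≤ f zero    fi rewrite fi = z≤n
first-≤ f (suc i) fi with f zero
... | true  = z≤n
... | false = s≤s (first-≤ (tail f) i fi)

first-anti : ∀ {n} {f g : Vector Bool n} → f ⊆ g → first g ≤ first f
first-anti {zero}  f⊆g = z≤n
first-anti {suc n} {f} {g} f⊆g with f zero | f⊆g zero
... | true  | p rewrite p refl = z≤n
... | false | _ with g zero
... | true  = z≤n
... | false = s≤s (first-anti (f⊆g ∘ suc))

first-member : ∀ {n} (f : Vector Bool n) i → first f ≡ toℕ i → f i ≡ true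
first-member {suc n} f i p with f zero in eq
first-member {suc n} f zero    p | true  = eq
first-member {suc n} f (suc i) p | false = first-member (tail f) i (ℕ.suc-injective p)

-- Places outside `V` are outside `U` as well, so both searches stop at the first element of `V`,
-- which `U` keeps.
find-first : ∀ {A : Set} {n} {U V : Vector Bool n} (v : Vector A n) → U ⊆ V →
             (∀ i → V i ≡ true → first V ≡ toℕ i → U i ≡ true) → find U v ≡ find V v
find-first {n = zero}  v U⊆V keep = refl
find-first {n = suc n} {U} {V} v U⊆V keep with V zero in V₀
... | true rewrite keep zero V₀ refl = refl
... | false with U zero in U₀
... | true  = contradiction (trans (sym (U⊆V zero U₀)) V₀) λ ()
... | false = find-first (tail v) (U⊆V ∘ suc) λ i Vi p → keep (suc i) Vi (cong suc p)

module _ {m n : ℕ} (b : Vector Bool m) where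

  merge : (s : ℕ) → (Fin m → Fin (suc s) → ℕ) → Vector Bool n
  merge s e i = or λ k → b k ∧ or λ x → e k x ≡ᵇ suc (toℕ i)

  mergeFirst : (Fin m → ℕ) → Vector Bool n
  mergeFirst e i = or λ k → b k ∧ (e k ≡ᵇ toℕ i)

module _ {m n : ℕ} (b : Vector Bool m) (f : Fin m → Vector Bool n) where

  union : Vector Bool n
  union i = or λ k → b k ∧ f k i

  ⊆-union : ∀ k → b k ≡ true → f k ⊆ union
  ⊆-union k bk i fi = or-intro _ k (∧-intro bk fi)

  -- An element with at most `s` successors in the union has at most `s` successors in any part that
  -- contains it, so the sketch of that part lists it.
  merge-≈ : ∀ s e → (∀ k x → e k x ≡ drops (toℕ x) (f k)) → merge b s e ≈⟨ s ⟩ union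
  merge-≈ s e e≡ = sound , complete
    where
    sound : merge b s e ⊆ union
    sound i p with or-elim (λ k → b k ∧ or λ x → e k x ≡ᵇ suc (toℕ i)) p
    ... | k , q with ∧-elim q
    ... | bk , q with or-elim (λ x → e k x ≡ᵇ suc (toℕ i)) q
    ... | x , q = ⊆-union k bk i (drops-member (toℕ x) (f k) i (trans (sym (e≡ k x)) (≡ᵇ-elim q)))
    complete : ∀ i → union i ≡ true → after union i ≤ s → merge b s e i ≡ true
    complete i p a≤s with or-elim (λ k → b k ∧ f k i) p
    ... | k , q with ∧-elim q
    ... | bk , fki = or-intro _ k (∧-intro bk (or-intro (λ x → e k x ≡ᵇ suc (toℕ i)) x (≡ᵇ-intro (begin
      e k x                        ≡⟨ e≡ k x ⟩
      drops (toℕ x) (f k)          ≡⟨ cong (λ y → drops y (f k)) (Fin.toℕ-fromℕ< x<) ⟩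
      drops (after (f k) i) (f k)  ≡⟨ drops-after (f k) i fki ⟩
      suc (toℕ i)                  ∎))))
      where
      open ≡-Reasoning
      x< : after (f k) i ℕ.< suc s
      x< = s≤s (ℕ.≤-trans (after-mono (⊆-union k bk) i) a≤s)
      x = fromℕ< x<

  -- The first element of the union is also the first element of every selected part that contains
  -- it, because no part begins before the union does.
  find-mergeFirst : ∀ {A : Set} e → (∀ k → e k ≡ first (f k)) → (v : Vector A n) →
                    find (mergeFirst b e) v ≡ find union v
  find-mergeFirst e e≡ v = find-first v sound complete
    where
    sound : mergeFirst b e ⊆ union
    sound i p with or-elim (λ k → b k ∧ (e k ≡ᵇ toℕ i)) p
    ... | k , q with ∧-elim q
    ... | bk , q = ⊆-union k bk i (first-member (f k) i (trans (sym (e≡ k)) (≡ᵇ-elim q)))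
    complete : ∀ i → union i ≡ true → first union ≡ toℕ i → mergeFirst b e i ≡ true
    complete i p p₁ with or-elim (λ k → b k ∧ f k i) p
    ... | k , q with ∧-elim q
    ... | bk , fki = or-intro _ k (∧-intro bk (≡ᵇ-intro (trans (e≡ k)
      (ℕ.≤-antisym (first-≤ (f k) i fki) (ℕ.≤-trans (ℕ.≤-reflexive (sym p₁)) (first-anti (⊆-union k bk)))))))

-- The expected ratio of a weight to the total weight.

2xy≤x²+y² : ∀ x y → 2 * (x * y) ≤ x * x + y * y
2xy≤x²+y² x y with ℕ.≤-total x y
... | inj₁ x≤y = subst (λ y → 2 * (x * y) ≤ x * x + y * y) (ℕ.m+[n∸m]≡n x≤y)
                   (ℕ.≤-trans (ℕ.m≤m+n _ ((y ∸ x) * (y ∸ x))) (ℕ.≤-reflexive (lemma x (y ∸ x))))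
  where
  lemma : ∀ x d → 2 * (x * (x + d)) + d * d ≡ x * x + (x + d) * (x + d)
  lemma = solve-∀
... | inj₂ y≤x = subst (λ x → 2 * (x * y) ≤ x * x + y * y) (ℕ.m+[n∸m]≡n y≤x)
                   (ℕ.≤-trans (ℕ.m≤m+n _ ((x ∸ y) * (x ∸ y))) (ℕ.≤-reflexive (lemma y (x ∸ y))))
  where
  lemma : ∀ y d → 2 * ((y + d) * y) + d * d ≡ (y + d) * (y + d) + y * y
  lemma = solve-∀

-- The weights w j are random variables on Fin p with the uniform distribution.
module _ {m p : ℕ} (w : Fin m → Fin p → ℕ) (a : Fin m → ℕ)
         (mean : ∀ j → sum (w j) ≡ p * a j)
         (second : ∀ j → 10 * ∑[ π < p ] (w j π * w j π) ≤ 11 * (p * (a j * a j))) where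

  private
    A : ℕ
    A = sum a

    W : Fin p → ℕ
    W π = ∑[ j < m ] w j π

  -- The weights need not be independent, so this is a Cauchy-Schwarz argument: `2xy≤x²+y²` is
  -- applied to `a k * w j π` and `a j * w k π`, summed over `π` and divided by `2 * (a j * a k)`.
  cross-moment : ∀ j k → 10 * ∑[ π < p ] (w j π * w k π) ≤ 11 * (p * (a j * a k))
  cross-moment j k with a j ℕ.* a k in eq
  ... | suc _ = ℕ.*-cancelˡ-≤ (2 * (a j * a k)) {{subst (λ x → NonZero (2 * x)) (sym eq) _}} (begin
      2 * (a j * a k) * (10 * ∑[ π < p ] (w j π * w k π))
        ≡⟨ lemma₁ (a j * a k) _ ⟩
      10 * (2 * (a j * a k) * ∑[ π < p ] (w j π * w k π))
        ≡⟨ cong (10 *_) (*-distribˡ-sum (2 * (a j * a k)) (λ π → w j π * w k π)) ⟩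
      10 * ∑[ π < p ] (2 * (a j * a k) * (w j π * w k π))
        ≤⟨ ℕ.*-monoʳ-≤ 10 (sum-mono λ π → pointwise (a j) (a k) (w j π) (w k π)) ⟩
      10 * ∑[ π < p ] (a k * a k * (w j π * w j π) + a j * a j * (w k π * w k π))
        ≡⟨ cong (10 *_) (∑-distrib-+ (λ π → a k * a k * (w j π * w j π)) (λ π → a j * a j * (w k π * w k π))) ⟩
      10 * (∑[ π < p ] (a k * a k * (w j π * w j π)) + ∑[ π < p ] (a j * a j * (w k π * w k π)))
        ≡⟨ cong₂ (λ x y → 10 * (x + y)) (*-distribˡ-sum (a k * a k) (λ π → w j π * w j π))
                                        (*-distribˡ-sum (a j * a j) (λ π → w k π * w k π)) ⟨
      10 * (a k * a k * ∑[ π < p ] (w j π * w j π) + a j * a j * ∑[ π < p ] (w k π * w k π))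
        ≡⟨ lemma₂ (a k * a k) (a j * a j) _ _ ⟩
      a k * a k * (10 * ∑[ π < p ] (w j π * w j π)) + a j * a j * (10 * ∑[ π < p ] (w k π * w k π))
        ≤⟨ ℕ.+-mono-≤ (ℕ.*-monoʳ-≤ (a k * a k) (second j)) (ℕ.*-monoʳ-≤ (a j * a j) (second k)) ⟩
      a k * a k * (11 * (p * (a j * a j))) + a j * a j * (11 * (p * (a k * a k)))
        ≡⟨ lemma₃ (a j) (a k) p ⟩
      2 * (a j * a k) * (11 * (p * (a j * a k)))
        ≡⟨ cong (λ x → 2 * (a j * a k) * (11 * (p * x))) eq ⟩
      2 * (a j * a k) * (11 * (p * suc _)) ∎)
    where
    open ℕ.≤-Reasoning
    lemma₁ : ∀ b x → 2 * b * (10 * x) ≡ 10 * (2 * b * x)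
    lemma₁ = solve-∀
    lemma₂ : ∀ b c x y → 10 * (b * x + c * y) ≡ b * (10 * x) + c * (10 * y)
    lemma₂ = solve-∀
    lemma₃ : ∀ a b p → b * b * (11 * (p * (a * a))) + a * a * (11 * (p * (b * b))) ≡ 2 * (a * b) * (11 * (p * (a * b)))
    lemma₃ = solve-∀
    lemma₄ : ∀ a b x y → 2 * (a * b) * (x * y) ≡ 2 * (b * x * (a * y))
    lemma₄ = solve-∀
    lemma₅ : ∀ a b x y → b * x * (b * x) + a * y * (a * y) ≡ b * b * (x * x) + a * a * (y * y)
    lemma₅ = solve-∀
    pointwise : ∀ a b x y → 2 * (a * b) * (x * y) ≤ b * b * (x * x) + a * a * (y * y)
    pointwise a b x y = begin
      2 * (a * b) * (x * y)                 ≡⟨ lemma₄ a b x y ⟩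
      2 * (b * x * (a * y))                 ≤⟨ 2xy≤x²+y² (b * x) (a * y) ⟩
      b * x * (b * x) + a * y * (a * y)     ≡⟨ lemma₅ a b x y ⟩
      b * b * (x * x) + a * a * (y * y)     ∎
  -- Division is impossible here, but a non-negative variable with mean zero vanishes everywhere.
  ... | zero = ℕ.≤-trans (ℕ.≤-reflexive (cong (10 *_) (trans (sum-cong-≗ vanish) (trans (sum-const p 0) (ℕ.*-zeroʳ p))))) z≤n
    where
    w≡0 : ∀ j → a j ≡ 0 → ∀ π → w j π ≡ 0
    w≡0 j a≡0 π = ℕ.n≤0⇒n≡0 (ℕ.≤-trans (sum-lower (w j) π)
      (ℕ.≤-reflexive (trans (mean j) (trans (cong (p *_) a≡0) (ℕ.*-zeroʳ p)))))
    vanish : ∀ π → w j π * w k π ≡ 0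
    vanish π with ℕ.m*n≡0⇒m≡0∨n≡0 (a j) eq
    ... | inj₁ aj≡0 = cong (_* w k π) (w≡0 j aj≡0 π)
    ... | inj₂ ak≡0 = trans (cong (w j π *_) (w≡0 k ak≡0 π)) (ℕ.*-zeroʳ (w j π))

  total-moment : ∀ j → 10 * ∑[ π < p ] (w j π * W π) ≤ 11 * (p * (a j * A))
  total-moment j = begin
    10 * ∑[ π < p ] (w j π * W π)
      ≡⟨ cong (10 *_) (sum-cong-≗ λ π → *-distribˡ-sum (w j π) (λ k → w k π)) ⟩
    10 * ∑[ π < p ] ∑[ k < m ] (w j π * w k π)
      ≡⟨ cong (10 *_) (∑-comm λ π k → w j π * w k π) ⟩
    10 * ∑[ k < m ] ∑[ π < p ] (w j π * w k π)
      ≡⟨ *-distribˡ-sum 10 (λ k → ∑[ π < p ] (w j π * w k π)) ⟩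
    ∑[ k < m ] (10 * ∑[ π < p ] (w j π * w k π))
      ≤⟨ sum-mono (cross-moment j) ⟩
    ∑[ k < m ] (11 * (p * (a j * a k)))
      ≡⟨ sum-cong-≗ (λ k → lemma p (a j) (a k)) ⟩
    ∑[ k < m ] (11 * (p * a j) * a k)
      ≡⟨ *-distribˡ-sum (11 * (p * a j)) a ⟨
    11 * (p * a j) * A
      ≡⟨ lemma p (a j) A ⟨
    11 * (p * (a j * A)) ∎
    where
    open ℕ.≤-Reasoning
    lemma : ∀ p a b → 11 * (p * (a * b)) ≡ 11 * (p * a) * b
    lemma = solve-∀

  -- E[w j / W] ≥ (9/10) a j / A, where x π / R stands for w j π / W π.
  ratio-lower : ∀ R j (x : Fin p → ℕ) → (∀ π → 0 ℕ.< W π → W π * x π ≡ R * w j π) →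
                .{{_ : NonZero A}} → 9 * (p * R * a j) ≤ 10 * (A * sum x)
  -- The second-moment term is added to both sides to avoid subtraction; the 9 is 20 - 11.
  ratio-lower R j x ratio = ℕ.*-cancelˡ-≤ A (ℕ.+-cancelʳ-≤ (R * (11 * (p * (a j * A)))) _ _ (begin
    A * (9 * (p * R * a j)) + R * (11 * (p * (a j * A)))
      ≡⟨ lemma₁ A p R (a j) ⟩
    10 * (2 * A * R * (p * a j))
      ≡⟨ cong (λ y → 10 * (2 * A * R * y)) (mean j) ⟨
    10 * (2 * A * R * sum (w j))
      ≡⟨ cong (10 *_) (*-distribˡ-sum (2 * A * R) (w j)) ⟩
    10 * ∑[ π < p ] (2 * A * R * w j π)
      ≤⟨ ℕ.*-monoʳ-≤ 10 (sum-mono pointwise) ⟩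
    10 * ∑[ π < p ] (A * A * x π + R * (w j π * W π))
      ≡⟨ cong (10 *_) (∑-distrib-+ (λ π → A * A * x π) (λ π → R * (w j π * W π))) ⟩
    10 * (∑[ π < p ] (A * A * x π) + ∑[ π < p ] (R * (w j π * W π)))
      ≡⟨ cong₂ (λ y z → 10 * (y + z)) (*-distribˡ-sum (A * A) x) (*-distribˡ-sum R (λ π → w j π * W π)) ⟨
    10 * (A * A * sum x + R * ∑[ π < p ] (w j π * W π))
      ≡⟨ lemma₂ A (sum x) R _ ⟩
    A * (10 * (A * sum x)) + R * (10 * ∑[ π < p ] (w j π * W π))
      ≤⟨ ℕ.+-monoʳ-≤ (A * (10 * (A * sum x))) (ℕ.*-monoʳ-≤ R (total-moment j)) ⟩
    A * (10 * (A * sum x)) + R * (11 * (p * (a j * A))) ∎))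
    where
    open ℕ.≤-Reasoning
    lemma₁ : ∀ A p R a → A * (9 * (p * R * a)) + R * (11 * (p * (a * A))) ≡ 10 * (2 * A * R * (p * a))
    lemma₁ = solve-∀
    lemma₂ : ∀ A X R Y → 10 * (A * A * X + R * Y) ≡ A * (10 * (A * X)) + R * (10 * Y)
    lemma₂ = solve-∀
    lemma₃ : ∀ W A R w → W * (2 * A * R * w) ≡ R * w * (2 * (A * W))
    lemma₃ = solve-∀
    lemma₄ : ∀ W A R w x → A * A * (W * x) + R * w * (W * W) ≡ W * (A * A * x + R * (w * W))
    lemma₄ = solve-∀
    lemma₅ : ∀ W A R w → R * w * (A * A + W * W) ≡ A * A * (R * w) + R * w * (W * W)
    lemma₅ = solve-∀
    -- This is 1 / W ≥ (2 A - W) / A² multiplied by `R * w j π * (A * A)`; it also holds for W = 0,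
    -- as `w j π` is then 0.
    pointwise : ∀ π → 2 * A * R * w j π ≤ A * A * x π + R * (w j π * W π)
    pointwise π with W π ℕ.≟ 0
    ... | yes W≡0 = ℕ.≤-trans (ℕ.≤-reflexive (trans
            (cong (2 * A * R *_) (ℕ.n≤0⇒n≡0 (ℕ.≤-trans (sum-lower (λ k → w k π) j) (ℕ.≤-reflexive W≡0))))
            (ℕ.*-zeroʳ (2 * A * R)))) z≤n
    ... | no  W≢0 = ℕ.*-cancelˡ-≤ (W π) {{ℕ.≢-nonZero W≢0}} (begin
      W π * (2 * A * R * w j π)                        ≡⟨ lemma₃ (W π) A R (w j π) ⟩
      R * w j π * (2 * (A * W π))                      ≤⟨ ℕ.*-monoʳ-≤ (R * w j π) (2xy≤x²+y² A (W π)) ⟩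
      R * w j π * (A * A + W π * W π)                  ≡⟨ lemma₅ (W π) A R (w j π) ⟩
      A * A * (R * w j π) + R * w j π * (W π * W π)    ≡⟨ cong (λ y → A * A * y + R * w j π * (W π * W π)) (ratio π (ℕ.n≢0⇒n>0 W≢0)) ⟨
      A * A * (W π * x π) + R * w j π * (W π * W π)    ≡⟨ lemma₄ (W π) A R (w j π) (x π) ⟩
      W π * (A * A * x π + R * (w j π * W π))          ∎)

-- Weights as unbiased estimates of column sizes.

∣! : ∀ {m n} → 0 ℕ.< m → m ≤ n → m ∣ n !
∣! {suc m} _ m≤n = ∣-trans (m∣m*n (m !)) (m≤n⇒m!∣n! m≤n)

-- The sketch size: E[weight²] ≤ (size / (size - 1)) E[weight]² then has the factor 11/10.
size : ℕ
size = 11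

over : ℕ → ℕ → ℕ
over G zero    = 0
over G (suc r) = G ℕ./ suc r

over≤ : ∀ G r → over G r ≤ G
over≤ G zero    = z≤n
over≤ G (suc r) = m/n≤m G (suc r)

over-inverts : ∀ n → InvertsUpTo 9 (n !) (over (n !)) n
over-inverts n r<n = m/n*n≡m (∣! (s≤s z≤n) r<n)

-- Scaled by n ! to be a natural number, and determined by the last size + 1 elements of f.
weight : ∀ {n} → Vector Bool n → ℕ
weight {n} f = if card f ≤ᵇ size then card f * n ! else size * n * over (n !) (prefix size f)

weight-small : ∀ {n} (f : Vector Bool n) → card f ≤ size → weight f ≡ card f * n !
weight-small f c≤s rewrite ≤⇒≤ᵇ≡true c≤s = refl

weight-large : ∀ {n} (f : Vector Bool n) → size ℕ.< card f → weight f ≡ size * n * over (n !) (prefix size f)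
weight-large f s<c rewrite ≰⇒≤ᵇ≡false s<c = refl

weight-≈ : ∀ {n} {U V : Vector Bool n} → U ≈⟨ size ⟩ V → weight U ≡ weight V
weight-≈ {n} {U} {V} U≈V with card V ℕ.≤? size
... | yes c≤s = trans (weight-small U (subst (_≤ size) (sym c≡) c≤s)) (trans (cong (_* n !) c≡) (sym (weight-small V c≤s)))
  where c≡ = ≈-card-≤ U≈V c≤s
... | no  c≰s = trans (weight-large U (≈-card-> U≈V s<c)) (trans (cong (λ r → size * n * over (n !) r) (prefix-≈ U≈V)) (sym (weight-large V s<c)))
  where s<c = ℕ.≰⇒> c≰s

-- Crude, but it affects only the amount of Bob's private randomness, which costs no communication.
maxWeight : ℕ → ℕ
maxWeight n = (n + size * n) * n !

weight≤ : ∀ {n} (f : Vector Bool n) → weight f ≤ maxWeight n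
weight≤ {n} f with card f ℕ.≤? size
... | yes c≤s = ℕ.≤-trans (ℕ.≤-reflexive (weight-small f c≤s))
                  (ℕ.*-monoˡ-≤ (n !) (ℕ.≤-trans (card≤n f) (ℕ.m≤m+n n (size * n))))
... | no  c≰s = ℕ.≤-trans (ℕ.≤-reflexive (weight-large f (ℕ.≰⇒> c≰s)))
                  (ℕ.*-mono-≤ (ℕ.m≤n+m (size * n) n) (over≤ (n !) (prefix size f)))

module _ {n : ℕ} (C : Vector Bool n) where

  private
    w : Fin (n !) → ℕ
    w π = weight (C ∘ order n π)

    small : card C ≤ size → ∀ π → w π ≡ card C * n !
    small c≤s π = trans (weight-small (C ∘ order n π) (subst (_≤ size) (sym (sum-∘order n π (ind ∘ C))) c≤s))
                        (cong (_* n !) (sum-∘order n π (ind ∘ C)))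

    large : size ℕ.< card C → ∀ π → w π ≡ size * n * over (n !) (prefix size (C ∘ order n π))
    large s<c π = weight-large (C ∘ order n π) (subst (size ℕ.<_) (sym (sum-∘order n π (ind ∘ C))) s<c)

    2≤n : size ℕ.< card C → 2 ≤ n
    2≤n s<c = ℕ.≤-trans (s≤s (s≤s z≤n)) (ℕ.≤-trans s<c (card≤n C))

  sum-weight : sum w ≡ n ! * (card C * n !)
  sum-weight with card C ℕ.≤? size
  ... | yes c≤s = trans (sum-cong-≗ (small c≤s)) (sum-const (n !) (card C * n !))
  ... | no  c≰s = begin
    sum w                                          ≡⟨ sum-cong-≗ (large s<c) ⟩
    ∑[ π < n ! ] (size * n * over (n !) (prefix size (C ∘ order n π)))
                                                   ≡⟨ *-distribˡ-sum (size * n) (λ π → over (n !) (prefix size (C ∘ order n π))) ⟨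
    size * n * prefixSum size (over (n !)) C       ≡⟨ prefix-moment₁ 9 (n !) (over (n !)) (over-inverts n) C (ℕ.<⇒≤ s<c) ⟩
    n ! * card C * n !                             ≡⟨ ℕ.*-assoc (n !) (card C) (n !) ⟩
    n ! * (card C * n !)                           ∎
    where
    open ≡-Reasoning
    s<c = ℕ.≰⇒> c≰s

  sum-weight² : 10 * ∑[ π < n ! ] (w π * w π) ≤ 11 * (n ! * ((card C * n !) * (card C * n !)))
  sum-weight² with card C ℕ.≤? size
  ... | yes c≤s = ℕ.*-mono-≤ (ℕ.n≤1+n 10) (ℕ.≤-reflexive (trans
          (sum-cong-≗ λ π → cong₂ _*_ (small c≤s π) (small c≤s π)) (sum-const (n !) _)))
  ... | no  c≰s = ℕ.*-cancelˡ-≤ (pred n) {{ℕ.>-nonZero (ℕ.pred-mono-≤ (2≤n s<c))}} (begin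
    pred n * (10 * ∑[ π < n ! ] (w π * w π))
      ≡⟨ cong (λ x → pred n * (10 * x)) (trans
           (sum-cong-≗ λ π → trans (cong₂ _*_ (large s<c π) (large s<c π)) (square (size * n) _))
           (sym (*-distribˡ-sum (size * n * (size * n)) (λ π → g² (prefix size (C ∘ order n π)))))) ⟩
    -- Since `fall size` is 110, the squared scale 121 leaves the factor 121/110 = 11/10.
    pred n * (10 * (size * n * (size * n) * Q))
      ≡⟨ lemma₁ n (pred n) Q ⟩
    size * n * (fall size * fall n * Q)
      ≤⟨ ℕ.*-monoʳ-≤ (size * n) (prefix-moment₂ 9 (n !) (over (n !)) (over-inverts n) C (ℕ.<⇒≤ s<c)) ⟩
    size * n * (n ! * fall (card C) * (n ! * n !))
      ≡⟨ lemma₂ n (n !) (card C) (pred (card C)) ⟩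
    -- By (c - 1) / (n - 1) ≤ c / n, falling factorials give way to squares.
    11 * (n ! * n ! * n ! * card C) * (n * pred (card C))
      ≤⟨ ℕ.*-monoʳ-≤ (11 * (n ! * n ! * n ! * card C)) (shift (card≤n C)) ⟩
    11 * (n ! * n ! * n ! * card C) * (card C * pred n)
      ≡⟨ lemma₃ (pred n) (n !) (card C) ⟩
    pred n * (11 * (n ! * ((card C * n !) * (card C * n !)))) ∎)
    where
    open ℕ.≤-Reasoning
    s<c = ℕ.≰⇒> c≰s
    g² : ℕ → ℕ
    g² r = over (n !) r * over (n !) r
    Q = prefixSum size g² C
    square : ∀ a x → a * x * (a * x) ≡ a * a * (x * x)
    square = solve-∀
    lemma₁ : ∀ n p Q → p * (10 * (11 * n * (11 * n) * Q)) ≡ 11 * n * (110 * (n * p) * Q)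
    lemma₁ = solve-∀
    lemma₂ : ∀ n G c d → 11 * n * (G * (c * d) * (G * G)) ≡ 11 * (G * G * G * c) * (n * d)
    lemma₂ = solve-∀
    lemma₃ : ∀ p G c → 11 * (G * G * G * c) * (c * p) ≡ p * (11 * (G * (c * G * (c * G))))
    lemma₃ = solve-∀
    shift : ∀ {c n} → c ≤ n → n * pred c ≤ c * pred n
    shift {zero}  {n}     c≤n = ℕ.≤-reflexive (ℕ.*-zeroʳ n)
    shift {suc c} {suc n} c≤n = ℕ.+-mono-≤ (ℕ.≤-pred c≤n) (ℕ.≤-reflexive (ℕ.*-comm n c))

-- The probability of each entry.

-- A multiple of every possible total weight W, so that reduction modulo W is exactly uniform.
opaque
  randomness : ℕ → ℕ → ℕ
  randomness m n = (m * maxWeight n) !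

  randomness-nonZero : ∀ m n → NonZero (randomness m n)
  randomness-nonZero m n = (m * maxWeight n) ℕ.!≢0

  ∣-randomness : ∀ {m n W} → 0 ℕ.< W → W ≤ m * maxWeight n → W ∣ randomness m n
  ∣-randomness = ∣!

module _ {m n : ℕ} (C : Fin m → Vector Bool n) where

  weights : Vector (Fin n) n → Vector ℕ m
  weights σ j = weight (C j ∘ σ)

  sum-weights≤ : ∀ σ → sum (weights σ) ≤ m * maxWeight n
  sum-weights≤ σ = ℕ.≤-trans (sum-mono λ j → weight≤ (C j ∘ σ)) (ℕ.≤-reflexive (sum-const m (maxWeight n)))

  hits : Fin n → Fin m → ℕ
  hits i j = ∑[ π₁ < n ! ] ∑[ π₂ < n ! ] ∑[ b < randomness m n ]
    ind ((choose (weights (order n π₁)) (toℕ b) is j) ∧ (firstIn (C j) (order n π₂) is i))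

  private
    chosen : Fin m → Fin (n !) → ℕ
    chosen j π₁ = ∑[ b < randomness m n ] ind (choose (weights (order n π₁)) (toℕ b) is j)

    leads : Fin n → Fin m → ℕ
    leads i j = ∑[ π₂ < n ! ] ind (firstIn (C j) (order n π₂) is i)

    ind-∧ : ∀ a b → ind (a ∧ b) ≡ ind a * ind b
    ind-∧ true  b = sym (ℕ.+-identityʳ (ind b))
    ind-∧ false b = refl

  -- The column depends on the first order and on `b`, the row only on the second order: the two
  -- choices are independent.
  hits-product : ∀ i j → hits i j ≡ sum (chosen j) * leads i j
  hits-product i j = trans (sum-cong-≗ λ π₁ → begin
      ∑[ π₂ < n ! ] ∑[ b < randomness m n ] ind ((choose (weights (order n π₁)) (toℕ b) is j) ∧ (firstIn (C j) (order n π₂) is i))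
        ≡⟨ sum-cong-≗ (λ π₂ → sum-cong-≗ {randomness m n} λ b → ind-∧ (choose (weights (order n π₁)) (toℕ b) is j) (firstIn (C j) (order n π₂) is i)) ⟩
      ∑[ π₂ < n ! ] ∑[ b < randomness m n ] (ind (choose (weights (order n π₁)) (toℕ b) is j) * ind (firstIn (C j) (order n π₂) is i))
        ≡⟨ sum-cong-≗ (λ π₂ → *-distribʳ-sum (ind (firstIn (C j) (order n π₂) is i)) (λ b → ind (choose (weights (order n π₁)) (toℕ {randomness m n} b) is j))) ⟨
      ∑[ π₂ < n ! ] (chosen j π₁ * ind (firstIn (C j) (order n π₂) is i))
        ≡⟨ *-distribˡ-sum (chosen j π₁) (λ π₂ → ind (firstIn (C j) (order n π₂) is i)) ⟨
      chosen j π₁ * leads i j ∎)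
    (sym (*-distribʳ-sum (leads i j) (chosen j)))
    where open ≡-Reasoning

  -- Column `j` is chosen with probability at least 9/10 of its share `card (C j)` of the total, and
  -- row `i` leads it with probability `1 / card (C j)`; the column size cancels.
  hits-lower : ∀ i j → C j i ≡ true →
    9 * (n ! * n ! * randomness m n) ≤ 10 * (∑[ k < m ] card (C k) * hits i j)
  hits-lower i j Cji = ℕ.*-cancelˡ-≤ (n !) {{ℕ.≢-nonZero n!≢0}} (begin
    n ! * (9 * (n ! * n ! * randomness m n))
      ≡⟨ lemma₁ (n !) (n !) (randomness m n) ⟩
    9 * (n ! * randomness m n * (n ! * n !))
      ≡⟨ cong (λ x → 9 * (n ! * randomness m n * (x * n !))) (count-firstIn n (C j) i Cji) ⟨
    9 * (n ! * randomness m n * (card (C j) * leads i j * n !))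
      ≡⟨ lemma₂ (n ! * randomness m n) (card (C j)) (leads i j) (n !) ⟩
    9 * (n ! * randomness m n * (card (C j) * n !)) * leads i j
      ≤⟨ ℕ.*-monoˡ-≤ (leads i j) (ratio-lower (λ j π₁ → weights (order n π₁) j) (λ k → card (C k) * n !)
           (λ k → sum-weight (C k)) (λ k → sum-weight² (C k)) (randomness m n) j (chosen j)
           (λ π₁ 0<W → count-choose (weights (order n π₁)) j (randomness m n) 0<W (∣-randomness 0<W (sum-weights≤ (order n π₁))))
           {{ℕ.>-nonZero 0<A}}) ⟩
    10 * (∑[ k < m ] (card (C k) * n !) * sum (chosen j)) * leads i j
      ≡⟨ cong (λ x → 10 * (x * sum (chosen j)) * leads i j) (*-distribʳ-sum (n !) (λ k → card (C k))) ⟨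
    10 * (∑[ k < m ] card (C k) * n ! * sum (chosen j)) * leads i j
      ≡⟨ lemma₃ (∑[ k < m ] card (C k)) (n !) (sum (chosen j)) (leads i j) ⟩
    n ! * (10 * (∑[ k < m ] card (C k) * (sum (chosen j) * leads i j)))
      ≡⟨ cong (λ x → n ! * (10 * (∑[ k < m ] card (C k) * x))) (hits-product i j) ⟨
    n ! * (10 * (∑[ k < m ] card (C k) * hits i j)) ∎)
    where
    open ℕ.≤-Reasoning
    n!≢0 : n ! ≢ 0
    n!≢0 = ℕ.≢-nonZero⁻¹ (n !) {{n ℕ.!≢0}}
    0<A : 0 ℕ.< ∑[ k < m ] (card (C k) * n !)
    0<A = ℕ.≤-trans (ℕ.*-mono-≤ (card-member (C j) i Cji) (ℕ.n≢0⇒n>0 n!≢0)) (sum-lower (λ k → card (C k) * n !) j)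
    lemma₁ : ∀ p q R → p * (9 * (p * q * R)) ≡ 9 * (p * R * (p * q))
    lemma₁ = solve-∀
    lemma₂ : ∀ p c l q → 9 * (p * (c * l * q)) ≡ 9 * (p * (c * q)) * l
    lemma₂ = solve-∀
    lemma₃ : ∀ c p x l → 10 * (c * p * x) * l ≡ p * (10 * (c * (x * l)))
    lemma₃ = solve-∀

-- Encoding numbers as bits.

value : ∀ {w} → Vector Bool w → ℕ
value {zero}  d = 0
value {suc w} d = ind (d zero) + value (tail d) * 2

value-cong : ∀ {w} {d d′ : Vector Bool w} → d ≗ d′ → value d ≡ value d′
value-cong {zero}  d≗d′ = refl
value-cong {suc w} d≗d′ = cong₂ (λ b x → ind b + x * 2) (d≗d′ zero) (value-cong (d≗d′ ∘ suc))

digits : ∀ w → ℕ → Vector Bool w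
digits (suc w) x = (x % 2 ≡ᵇ 1) ∷ digits w (x ℕ./ 2)

value-digits : ∀ w x → x ℕ.< 2 ^ w → value (digits w x) ≡ x
value-digits zero    zero x<1 = refl
value-digits zero    (suc x) (s≤s ())
value-digits (suc w) x x<2^w = begin
  ind (x % 2 ≡ᵇ 1) + value (digits w (x ℕ./ 2)) * 2
    ≡⟨ cong₂ (λ b y → b + y * 2) (parity (m%n<n x 2)) (value-digits w (x ℕ./ 2) (m<n*o⇒m/o<n (subst (x ℕ.<_) (ℕ.*-comm 2 (2 ^ w)) x<2^w))) ⟩
  x % 2 + x ℕ./ 2 * 2
    ≡⟨ m≡m%n+[m/n]*n x 2 ⟨
  x ∎
  where
  open ≡-Reasoning
  parity : ∀ {r} → r ℕ.< 2 → ind (r ≡ᵇ 1) ≡ r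
  parity {zero}        r<2 = refl
  parity {suc zero}    r<2 = refl
  parity {suc (suc r)} (s≤s (s≤s ()))

encode : ∀ {m} w → (Fin m → ℕ) → Vec Bool (m * w)
encode {m} w x = tabulate λ z → let (i , d) = remQuot {m} w z in digits w (x i) d

decode : ∀ {m} w → Vec Bool (m * w) → Fin m → ℕ
decode w v i = value λ d → lookup v (combine i d)

decode-encode : ∀ {m} w (x : Fin m → ℕ) → (∀ i → x i ℕ.< 2 ^ w) → decode w (encode w x) ≗ x
decode-encode {m} w x x< i = trans (value-cong λ d → trans (lookup∘tabulate _ (combine i d))
  (cong (λ (i , d) → digits w (x i) d) (Fin.remQuot-combine {m} i d))) (value-digits w (x i) (x< i))

-- An arbitrary bit string may decode to a number that is no row; messages that Alice sends never
-- reach the default.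
clamp : ∀ {n} → Fin n → ℕ → Fin n
clamp {n} i₀ x with x ℕ.<? n
... | yes x<n = fromℕ< x<n
... | no  _   = i₀

clamp-toℕ : ∀ {n} (i₀ i : Fin n) → clamp i₀ (toℕ i) ≡ i
clamp-toℕ {n} i₀ i with toℕ i ℕ.<? n
... | yes i<n = Fin.fromℕ<-toℕ i i<n
... | no  i≮n = contradiction (Fin.toℕ<n i) i≮n

-- The protocol.

bit : Fin 2 → Bool
bit zero    = false
bit (suc _) = true

column : ∀ {n} → Matrix (Fin 2) n → Fin n → Vector Bool n
column M j i = bit (M i j)

support : ∀ {n} → (A B : Matrix (Fin 2) n) → Fin n → Vector Bool n
support A B j = union (column B j) (column A)

module Sampler {n : ℕ} (i₀ : Fin n) (w : ℕ) (n<2^w : n ℕ.< 2 ^ w) where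

  -- Per column k of A: the first element in the second order, the k-th element
  -- of that order, and the places of the last size + 1 elements in the first order,
  -- which is read backwards.
  numbers : Matrix (Fin 2) n → (σ₁ σ₂ : Vector (Fin n) n) → Fin n → Fin (3 + size) → ℕ
  numbers A σ₁ σ₂ k zero          = first (column A k ∘ σ₂)
  numbers A σ₁ σ₂ k (suc zero)    = toℕ (σ₂ k)
  numbers A σ₁ σ₂ k (suc (suc x)) = drops (toℕ x) (column A k ∘ σ₁)

  numbers≤ : ∀ A σ₁ σ₂ k q → numbers A σ₁ σ₂ k q ≤ n
  numbers≤ A σ₁ σ₂ k zero          = first≤n (column A k ∘ σ₂)
  numbers≤ A σ₁ σ₂ k (suc zero)    = ℕ.<⇒≤ (Fin.toℕ<n (σ₂ k))
  numbers≤ A σ₁ σ₂ k (suc (suc x)) = drops≤n (toℕ x) (column A k ∘ σ₁)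

  Message : Set
  Message = Vec Bool (n * (3 + size) * w)

  message : Matrix (Fin 2) n → Fin (n ! * n !) → Message
  message A π = let (π₁ , π₂) = remQuot {n !} (n !) π in
    encode w λ z → uncurry (numbers A (order n π₁) (order n π₂)) (remQuot {n} (3 + size) z)

  received : Message → Fin n → Fin (3 + size) → ℕ
  received v k q = decode w v (combine k q)

  received-message : ∀ A π k q → let (π₁ , π₂) = remQuot {n !} (n !) π in
    received (message A π) k q ≡ numbers A (order n π₁) (order n π₂) k q
  received-message A π k q = let (π₁ , π₂) = remQuot {n !} (n !) π in trans
    (decode-encode w (λ z → uncurry (numbers A (order n π₁) (order n π₂)) (remQuot {n} (3 + size) z))
      (λ z → let (k , q) = remQuot {n} (3 + size) z in
        ℕ.≤-<-trans (numbers≤ A (order n π₁) (order n π₂) k q) n<2^w) (combine k q))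
    (cong (uncurry (numbers A (order n π₁) (order n π₂))) (Fin.remQuot-combine {n} k q))

  columnWeights : Matrix (Fin 2) n → Message → Vector ℕ n
  columnWeights B v j = weight {n} (merge (column B j) size λ k x → received v k (suc (suc x)))

  -- Randomness is private, so the second order itself is read from the message to turn a place into
  -- a row. Weights depend on places alone, hence no such table for the first order.
  firstRow : Matrix (Fin 2) n → Message → Fin n → Maybe (Fin n)
  firstRow B v j = find (mergeFirst {n = n} (column B j) λ k → received v k zero) λ k → clamp i₀ (received v k (suc zero))

  -- Default answers do no harm, since only lower bounds on the numbers of outcomes are claimed.
  guess : Matrix (Fin 2) n → Message → ℕ → Fin n × Fin n
  guess B v b = maybe′ (λ j → fromMaybe i₀ (firstRow B v j) , j) (i₀ , i₀) (choose (columnWeights B v) b)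

  R : ℕ
  R = randomness n n

  sampler : MatrixProtocol n
  sampler = record
    { randA         = n ! * n !
    ; randB         = R
    ; randA-nonZero = ℕ.m*n≢0 (n !) (n !) {{n ℕ.!≢0}} {{n ℕ.!≢0}}
    ; randB-nonZero = randomness-nonZero n n
    ; protocol      = send _ (λ (A , π) → message A π) λ v → output λ (B , b) → guess B v (toℕ b)
    }

  -- The 14 is `3 + size`, and `w ^ 1` has the shape of the bound with exponent 1.
  bits-sampler : ∀ A B ω → bitsOn sampler A B ω ≡ 14 * n * w ^ 1
  bits-sampler A B ω = lemma n w
    where
    lemma : ∀ n w → n * 14 * w + 0 ≡ 14 * n * (w * 1)
    lemma = solve-∀

  rounds-sampler : HasRounds sampler 1
  rounds-sampler A B ω = refl

  module _ (A B : Matrix (Fin 2) n) (π : Fin (n ! * n !)) where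

    private
      π₁ = proj₁ (remQuot {n !} (n !) π)
      π₂ = proj₂ (remQuot {n !} (n !) π)
      v  = message A π

    columnWeights-message : columnWeights B v ≗ weights (support A B) (order n π₁)
    columnWeights-message j = weight-≈ (merge-≈ (column B j) (λ k → column A k ∘ order n π₁) size
      (λ k x → received v k (suc (suc x))) (λ k x → received-message A π k (suc (suc x))))

    firstRow-message : ∀ j → firstRow B v j ≡ firstIn (support A B j) (order n π₂)
    firstRow-message j = trans
      (find-cong (mergeFirst {n = n} (column B j) λ k → received v k zero)
        (λ k → trans (cong (clamp i₀) (received-message A π k (suc zero))) (clamp-toℕ i₀ (order n π₂ k))))
      (find-mergeFirst (column B j) (λ k → column A k ∘ order n π₂) (λ k → received v k zero)
        (λ k → received-message A π k zero) (order n π₂))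

    guess-message : ∀ i j b → (choose (weights (support A B) (order n π₁)) b is j) ≡ true →
                    (firstIn (support A B j) (order n π₂) is i) ≡ true → guess B v b ≡ (i , j)
    guess-message i j b p q = trans
      (cong (maybe′ (λ j → fromMaybe i₀ (firstRow B v j) , j) (i₀ , i₀))
        (trans (choose-cong columnWeights-message b) (is-sound (choose (weights (support A B) (order n π₁)) b) j p)))
      (cong (λ x → fromMaybe i₀ x , j)
        (trans (firstRow-message j) (is-sound (firstIn (support A B j) (order n π₂)) i q)))

  outputs-lower : ∀ A B i j → hits (support A B) i j ≤
    ∑[ a < n ! * n ! ] ∑[ b < R ] ind (outputs sampler A B i j (a , b))
  outputs-lower A B i j = ℕ.≤-trans
    (ℕ.≤-reflexive (sym (sum-remQuot (n !) λ (π₁ , π₂) → ∑[ b < R ]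
      ind ((choose (weights (support A B) (order n π₁)) (toℕ b) is j) ∧ (firstIn (support A B j) (order n π₂) is i)))))
    (sum-mono λ π → sum-mono λ b → ind-mono _ _ λ p → let (q , r) = ∧-elim p in
      trans (isYes≗does (outcome≟ π b)) (dec-true (outcome≟ π b) (guess-message A B π i j (toℕ b) q r)))
    where
    outcome≟ : ∀ π (b : Fin R) → Dec (guess B (message A π) (toℕ b) ≡ (i , j))
    outcome≟ π b = ≡-dec Fin._≟_ Fin._≟_ (guess B (message A π) (toℕ b)) (i , j)

-- Counts over lists as sums.

module _ {A : Set} {P : A → Set} (P? : ∀ x → Dec (P x)) where

  private
    count : List A → ℕ
    count xs = length (filter P? xs)

  count-∷ : ∀ x xs → count (x List.∷ xs) ≡ ind (does (P? x)) + count xs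
  count-∷ x xs with does (P? x)
  ... | true  = refl
  ... | false = refl

  count-++ : ∀ xs ys → count (xs List.++ ys) ≡ count xs + count ys
  count-++ xs ys = trans (cong length (List.filter-++ P? xs ys)) (List.length-++ (filter P? xs))

  count-map-tabulate : ∀ {B : Set} {n} (g : B → A) (f : Fin n → B) →
    count (List.map g (List.tabulate f)) ≡ ∑[ i < n ] ind (does (P? (g (f i))))
  count-map-tabulate {n = zero}  g f = refl
  count-map-tabulate {n = suc n} g f = trans (count-∷ (g (f zero)) _)
    (cong (ind (does (P? (g (f zero)))) +_) (count-map-tabulate g (f ∘ suc)))

count-allFin² : ∀ m n {P : Fin m × Fin n → Set} (P? : ∀ x → Dec (P x)) →
  length (filter P? (cartesianProduct (allFin m) (allFin n))) ≡ ∑[ i < m ] ∑[ j < n ] ind (does (P? (i , j)))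
count-allFin² m n P? = rows m id
  where
  rows : ∀ k (f : Fin k → Fin m) → length (filter P? (cartesianProduct (List.tabulate f) (allFin n)))
                                 ≡ ∑[ i < k ] ∑[ j < n ] ind (does (P? (f i , j)))
  rows zero    f = refl
  rows (suc k) f = trans (count-++ P? (List.map (f zero ,_) (allFin n)) _)
    (cong₂ _+_ (count-map-tabulate P? (f zero ,_) id) (rows k (f ∘ suc)))

#-sum : ∀ {X Y O} (P : RandomizedProtocol X Y O) (E : Event P) →
        #_ P E ≡ ∑[ a < randA P ] ∑[ b < randB P ] ind (E (a , b))
#-sum P E = count-allFin² (randA P) (randB P) _

-- Trimming the outcomes of all entries to the same number.

subevent : ∀ {n} (f : Vector Bool n) q → q ≤ card f → Σ[ g ∈ Vector Bool n ] g ⊆ f × card g ≡ q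
subevent {n} f zero    q≤c = (λ _ → false) , (λ _ ()) , trans (sum-const n 0) (ℕ.*-zeroʳ n)
subevent {suc n} f (suc q) q≤c with f zero in f₀
... | true  = let (g , g⊆f , g≡q) = subevent (tail f) q (ℕ.≤-pred q≤c) in
  (true ∷ g) , (λ { zero _ → f₀ ; (suc i) → g⊆f i }) , cong suc g≡q
... | false = let (g , g⊆f , g≡q) = subevent (tail f) (suc q) q≤c in
  (false ∷ g) , (λ { zero () ; (suc i) → g⊆f i }) , g≡q

sum-single : ∀ {n} (f : Vector ℕ n) i → (∀ k → k ≢ i → f k ≡ 0) → sum f ≡ f i
sum-single {suc n} f i vanish = trans (sum-remove {i = i} f) (trans (cong (f i +_) (trans
  (sum-cong-≗ λ k → vanish (punchIn i k) (Fin.punchInᵢ≢i i k)) (trans (sum-const n 0) (ℕ.*-zeroʳ n)))) (ℕ.+-identityʳ (f i)))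

module Trim {m n M : ℕ} (out : Fin M → Fin m × Fin n) (S : Fin m → Fin n → Bool) (q : ℕ)
            (q≤ : ∀ i j → S i j ≡ true → q ≤ ∑[ x < M ] ind (does (≡-dec Fin._≟_ Fin._≟_ (out x) (i , j)))) where

  private
    is : Fin m → Fin n → Vector Bool M
    is i j x = does (≡-dec Fin._≟_ Fin._≟_ (out x) (i , j))

    is-sound′ : ∀ i j x → is i j x ≡ true → out x ≡ (i , j)
    is-sound′ i j x p with ≡-dec Fin._≟_ Fin._≟_ (out x) (i , j)
    ... | yes eq = eq

    part : ∀ i j → Σ[ g ∈ Vector Bool M ] g ⊆ is i j × card g ≡ q * ind (S i j)
                                        × (∀ x → g x ≡ true → S i j ≡ true)
    part i j with S i j in eq
    ... | true  = let (g , g⊆ , c) = subevent (is i j) q (q≤ i j eq) in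
      g , g⊆ , trans c (sym (ℕ.*-identityʳ q)) , λ _ _ → refl
    ... | false = (λ _ → false) , (λ _ ()) , trans (trans (sum-const M 0) (ℕ.*-zeroʳ M)) (sym (ℕ.*-zeroʳ q)) , λ _ ()

    member : Fin m → Fin n → Vector Bool M
    member i j = proj₁ (part i j)

    member-is : ∀ i j x → member i j x ≡ true → out x ≡ (i , j)
    member-is i j x p = is-sound′ i j x (proj₁ (proj₂ (part i j)) x p)

    member-other : ∀ i j x → out x ≢ (i , j) → member i j x ≡ false
    member-other i j x ne = Bool.¬-not (ne ∘ member-is i j x)

  -- Membership is decided in the part that belongs to the outcome's own output, so the parts are
  -- disjoint by construction.
  event : Vector Bool M
  event x = uncurry member (out x) x

  event-sound : ∀ x → event x ≡ true → uncurry S (out x) ≡ true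
  event-sound x = proj₂ (proj₂ (proj₂ (uncurry part (out x)))) x

  event-part : ∀ i j → S i j ≡ true → card (λ x → is i j x ∧ event x) ≡ q
  event-part i j Sij = trans (sum-cong-≗ λ x → cong ind (pointwise x))
    (trans (proj₁ (proj₂ (proj₂ (part i j)))) (trans (cong (λ b → q * ind b) Sij) (ℕ.*-identityʳ q)))
    where
    pointwise : ∀ x → is i j x ∧ event x ≡ member i j x
    pointwise x with ≡-dec Fin._≟_ Fin._≟_ (out x) (i , j)
    ... | yes eq = cong (λ (i , j) → member i j x) eq
    ... | no  ne = sym (member-other i j x ne)

  card-event : card event ≡ q * ∑[ i < m ] ∑[ j < n ] ind (S i j)
  card-event = begin
    ∑[ x < M ] ind (event x)
      ≡⟨ sum-cong-≗ (λ x → spread x) ⟨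
    ∑[ x < M ] ∑[ i < m ] ∑[ j < n ] ind (member i j x)
      ≡⟨ ∑-comm (λ x i → ∑[ j < n ] ind (member i j x)) ⟩
    ∑[ i < m ] ∑[ x < M ] ∑[ j < n ] ind (member i j x)
      ≡⟨ sum-cong-≗ (λ i → ∑-comm (λ x j → ind (member i j x))) ⟩
    ∑[ i < m ] ∑[ j < n ] card (member i j)
      ≡⟨ sum-cong-≗ (λ i → sum-cong-≗ λ j → proj₁ (proj₂ (proj₂ (part i j)))) ⟩
    ∑[ i < m ] ∑[ j < n ] (q * ind (S i j))
      ≡⟨ sum-cong-≗ (λ i → *-distribˡ-sum q (ind ∘ S i)) ⟨
    ∑[ i < m ] (q * ∑[ j < n ] ind (S i j))
      ≡⟨ *-distribˡ-sum q (λ i → ∑[ j < n ] ind (S i j)) ⟨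
    q * ∑[ i < m ] ∑[ j < n ] ind (S i j) ∎
    where
    open ≡-Reasoning
    -- Only the part indexed by the output of `x` can contain `x`.
    spread : ∀ x → ∑[ i < m ] ∑[ j < n ] ind (member i j x) ≡ ind (event x)
    spread x = trans
      (sum-single (λ i → ∑[ j < n ] ind (member i j x)) (proj₁ (out x)) λ i ne → trans
        (sum-cong-≗ λ j → cong ind (member-other i j x (ne ∘ sym ∘ cong proj₁))) (trans (sum-const n 0) (ℕ.*-zeroʳ n)))
      (sum-single (λ j → ind (member (proj₁ (out x)) j x)) (proj₂ (out x)) λ j ne →
        cong ind (member-other (proj₁ (out x)) j x (ne ∘ sym ∘ cong proj₂)))

-- Non-zero entries as members of unions.

private
  nonZero? : ∀ {n} (C : Matrix ℤ n) → Fin n → Fin n → Bool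
  nonZero? C i j = does (¬? (C i j ℤ.≟ 0ℤ))

‖‖₀-sum : ∀ {n} (C : Matrix ℤ n) → ‖ C ‖₀ ≡ ∑[ i < n ] ∑[ j < n ] ind (nonZero? C i j)
‖‖₀-sum {n} C = count-allFin² n n λ (i , j) → ¬? (C i j ℤ.≟ 0ℤ)

-- All terms of the integer sum are non-negative, so nothing cancels: the entry is non-zero exactly
-- when some term is.
nonZero-support : ∀ {n} (A B : Matrix (Fin 2) n) i j → nonZero? (A ⊗ B) i j ≡ support A B j i
nonZero-support {n} A B i j = terms (A i) (λ k → B k j)
  where
  term-zero : ∀ (a b : Fin 2) → bit b ∧ bit a ≡ false → ℤ.+ toℕ a ℤ.* ℤ.+ toℕ b ≡ 0ℤ
  term-zero zero    b       p = refl
  term-zero (suc a) zero    p = ℤ.*-zeroʳ (ℤ.+ toℕ (suc a))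
  term-nonNeg : ∀ (a b : Fin 2) → ℤ.+ toℕ a ℤ.* ℤ.+ toℕ b ≡ ℤ.+ (toℕ a * toℕ b)
  term-nonNeg a b = sym (ℤ.pos-* (toℕ a) (toℕ b))
  term-pos : ∀ (a b : Fin 2) → bit b ∧ bit a ≡ true → 1 ≤ toℕ a * toℕ b
  term-pos (suc a) (suc b) p = s≤s z≤n
  total : ∀ {m} (x y : Fin m → Fin 2) → ℤ-Sum.sum (λ k → ℤ.+ toℕ (x k) ℤ.* ℤ.+ toℕ (y k)) ≡ ℤ.+ ∑[ k < m ] (toℕ (x k) * toℕ (y k))
  total {zero}  x y = refl
  total {suc m} x y = cong₂ ℤ._+_ (term-nonNeg (x zero) (y zero)) (total (x ∘ suc) (y ∘ suc))
  vanish : ∀ {m} (x y : Fin m → Fin 2) → or (λ k → bit (y k) ∧ bit (x k)) ≡ false →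
           ℤ-Sum.sum (λ k → ℤ.+ toℕ (x k) ℤ.* ℤ.+ toℕ (y k)) ≡ 0ℤ
  vanish {zero}  x y p = refl
  vanish {suc m} x y p with bit (y zero) ∧ bit (x zero) in eq
  ... | false = cong₂ ℤ._+_ (term-zero (x zero) (y zero) eq) (vanish (x ∘ suc) (y ∘ suc) p)
  terms : ∀ {m} (x y : Fin m → Fin 2) →
          does (¬? (ℤ-Sum.sum (λ k → ℤ.+ toℕ (x k) ℤ.* ℤ.+ toℕ (y k)) ℤ.≟ 0ℤ)) ≡ or (λ k → bit (y k) ∧ bit (x k))
  terms x y with or (λ k → bit (y k) ∧ bit (x k)) in eq
  ... | false = dec-false (¬? (_ ℤ.≟ 0ℤ)) (λ ne → ne (vanish x y eq))
  ... | true with or-elim (λ k → bit (y k) ∧ bit (x k)) eq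
  ... | k , p = dec-true (¬? (_ ℤ.≟ 0ℤ)) λ z → ℕ.<⇒≢
          (ℕ.≤-trans (term-pos (x k) (y k) p) (sum-lower (λ k → toℕ (x k) * toℕ (y k)) k))
          (sym (ℤ.+-injective (trans (sym (total x y)) z)))

‖‖₀-support : ∀ {n} (A B : Matrix (Fin 2) n) → ‖ A ⊗ B ‖₀ ≡ ∑[ j < n ] card (support A B j)
‖‖₀-support {n} A B = trans (‖‖₀-sum (A ⊗ B)) (trans
  (sum-cong-≗ λ i → sum-cong-≗ λ j → cong ind (nonZero-support A B i j))
  (∑-comm λ i j → ind (support A B j i)))

-- From lower bounds on outcomes to sampling.

/-mono-≤ : ∀ a b c d .{{_ : NonZero b}} .{{_ : NonZero d}} → a * d ≤ c * b → ℤ.+ a / b ℚ.≤ ℤ.+ c / d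
/-mono-≤ a (suc b) c (suc d) ad≤cb = ℚ.toℚᵘ-cancel-≤ (begin
  ℚ.toℚᵘ (ℤ.+ a / suc b)  ≃⟨ ℚ.toℚᵘ-fromℚᵘ (mkℚᵘ (ℤ.+ a) b) ⟩
  mkℚᵘ (ℤ.+ a) b          ≤⟨ ℚᵘ.*≤* (subst₂ ℤ._≤_ (ℤ.pos-* a (suc d)) (ℤ.pos-* c (suc b)) (ℤ.+≤+ ad≤cb)) ⟩
  mkℚᵘ (ℤ.+ c) d          ≃⟨ ℚ.toℚᵘ-fromℚᵘ (mkℚᵘ (ℤ.+ c) d) ⟨
  ℚ.toℚᵘ (ℤ.+ c / suc d)  ∎)
  where open ℚᵘ.≤-Reasoning

1-ε≤1 : ∀ ε .{{_ : NonNegative ε}} → 1ℚ ℚ.- ε ℚ.≤ 1ℚ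
1-ε≤1 ε = subst (1ℚ ℚ.- ε ℚ.≤_) (ℚ.+-identityʳ 1ℚ) (ℚ.+-monoʳ-≤ 1ℚ (ℚ.neg-antimono-≤ (ℚ.nonNegative⁻¹ ε)))

1≤1+ε : ∀ ε .{{_ : NonNegative ε}} → 1ℚ ℚ.≤ 1ℚ ℚ.+ ε
1≤1+ε ε = subst (ℚ._≤ 1ℚ ℚ.+ ε) (ℚ.+-identityʳ 1ℚ) (ℚ.+-monoʳ-≤ 1ℚ (ℚ.nonNegative⁻¹ ε))

outcomes : ∀ {n} (P : MatrixProtocol n) (A B : Matrix (Fin 2) n) → Fin n → Fin n → ℕ
outcomes P A B i j = ∑[ a < randA P ] ∑[ b < randB P ] ind (outputs P A B i j (a , b))

-- As the event of a sampler is arbitrary, lower bounds on the output probabilities suffice: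
-- cutting down the outcomes of every non-zero entry to the same number q leaves an
-- exactly uniform distribution.
module _ {n : ℕ} (P : MatrixProtocol n)
         (lower : ∀ A B i j → support A B j i ≡ true →
                  9 * (randA P * randB P) ≤ 10 * (‖ A ⊗ B ‖₀ * outcomes P A B i j))
         (ε : ℚ) .{{_ : NonNegative ε}} where

  lower⇒ℓ₀-Sampler : ℓ₀-Sampler ε (ℤ.+ 1 / 10) P
  lower⇒ℓ₀-Sampler A B {{N≢0}} = E , success , E≢0 , record
    { nonZeroEntry = λ ω Eω → nonZero-elim (subst (λ x → uncurry S (outputOn P A B x) ≡ true)
        (Fin.remQuot-combine (proj₁ ω) (proj₂ ω)) (Trimmed.event-sound (uncurry combine ω) (Equivalence.to Bool.T-≡ Eω)))
    -- The conditional probability is exactly q / (q N) = 1 / N, which lies between both bounds.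
    ; lower = λ i j ne → ℚ.≤-trans
        (subst ((1ℚ ℚ.- ε) ℚ.* (ℤ.+ 1 / N) ℚ.≤_) (ℚ.*-identityˡ (ℤ.+ 1 / N))
          (ℚ.*-monoʳ-≤-nonNeg (ℤ.+ 1 / N) {{1/N≥0}} (1-ε≤1 ε)))
        (/-mono-≤ 1 N (count (both i j)) (count E) {{N≢0}} {{E≢0}} (ℕ.≤-reflexive (part-ratio i j ne)))
    ; upper = λ i j ne → ℚ.≤-trans
        (/-mono-≤ (count (both i j)) (count E) 1 N {{E≢0}} {{N≢0}} (ℕ.≤-reflexive (sym (part-ratio i j ne))))
        (subst (ℚ._≤ (1ℚ ℚ.+ ε) ℚ.* (ℤ.+ 1 / N)) (ℚ.*-identityˡ (ℤ.+ 1 / N))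
          (ℚ.*-monoʳ-≤-nonNeg (ℤ.+ 1 / N) {{1/N≥0}} (1≤1+ε ε)))
    }
    where
    N M q : ℕ
    N = ‖ A ⊗ B ‖₀
    M = randA P * randB P
    instance
      10N≢0 : NonZero (10 * N)
      10N≢0 = ℕ.m*n≢0 10 N
    1/N≥0 : NonNegative (ℤ.+ 1 / N)
    1/N≥0 = ℚ.normalize-nonNeg 1 N
    -- This is 9 M / (10 N) rounded up: large enough for N parts of size `q` to fill 9/10 of the
    -- outcomes, and, being the least such integer, at most the number of outcomes of each non-zero
    -- entry.
    q = suc (pred (9 * M) ℕ./ (10 * N))

    0<9M : 0 ℕ.< 9 * M
    0<9M = ℕ.>-nonZero⁻¹ (9 * M) {{ℕ.m*n≢0 9 M {{_}} {{ℕ.m*n≢0 (randA P) (randB P)}}}}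

    9M≤ : 9 * M ≤ q * (10 * N)
    9M≤ = subst (_≤ q * (10 * N)) (ℕ.suc-pred (9 * M) {{ℕ.>-nonZero 0<9M}}) (begin-strict
      pred (9 * M)                                                ≡⟨ m≡m%n+[m/n]*n (pred (9 * M)) (10 * N) ⟩
      pred (9 * M) ℕ.% (10 * N) + pred (9 * M) ℕ./ (10 * N) * (10 * N) <⟨ ℕ.+-monoˡ-< _ (m%n<n (pred (9 * M)) (10 * N)) ⟩
      q * (10 * N)                                                ∎)
      where open ℕ.≤-Reasoning

    S : Fin n → Fin n → Bool
    S i j = does (¬? ((A ⊗ B) i j ℤ.≟ 0ℤ))

    nonZero-elim : ∀ {i j} → S i j ≡ true → (A ⊗ B) i j ≢ 0ℤ
    nonZero-elim {i} {j} p with (A ⊗ B) i j ℤ.≟ 0ℤ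
    ... | no ne = ne

    out : Fin M → Fin n × Fin n
    out x = outputOn P A B (remQuot {randA P} (randB P) x)

    outcomes-out : ∀ i j → outcomes P A B i j ≡ ∑[ x < M ] ind (does (≡-dec Fin._≟_ Fin._≟_ (out x) (i , j)))
    outcomes-out i j = trans (sym (sum-remQuot (randA P) (ind ∘ outputs P A B i j)))
      (sum-cong-≗ λ x → cong ind (isYes≗does (≡-dec Fin._≟_ Fin._≟_ (out x) (i , j))))

    q≤ : ∀ i j → S i j ≡ true → q ≤ ∑[ x < M ] ind (does (≡-dec Fin._≟_ Fin._≟_ (out x) (i , j)))
    q≤ i j Sij = subst (q ≤_) (outcomes-out i j) (m<n*o⇒m/o<n (begin-strict
      pred (9 * M)                      <⟨ ℕ.≤-reflexive (ℕ.suc-pred (9 * M) {{ℕ.>-nonZero 0<9M}}) ⟩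
      9 * M                             ≤⟨ lower A B i j (trans (sym (nonZero-support A B i j)) Sij) ⟩
      10 * (N * outcomes P A B i j)     ≡⟨ lemma N (outcomes P A B i j) ⟩
      outcomes P A B i j * (10 * N)     ∎))
      where
      open ℕ.≤-Reasoning
      lemma : ∀ N x → 10 * (N * x) ≡ x * (10 * N)
      lemma = solve-∀

    module Trimmed = Trim out S q q≤

    E : Event P
    E ω = Trimmed.event (uncurry combine ω)

    count : Event P → ℕ
    count = #_ P

    both : Fin n → Fin n → Event P
    both i j ω = outputs P A B i j ω ∧ E ω

    count-E : count E ≡ q * N
    count-E = trans (#-sum P E) (trans (sym (sum-combine (randA P) (ind ∘ Trimmed.event)))
      (trans Trimmed.card-event (cong (q *_) (sym (‖‖₀-sum (A ⊗ B))))))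

    count-both : ∀ i j → (A ⊗ B) i j ≢ 0ℤ → count (both i j) ≡ q
    count-both i j ne = trans (#-sum P (both i j)) (trans
      (sum-cong-≗ λ a → sum-cong-≗ λ b → cong (λ c → ind (c ∧ E (a , b))) (trans
        (isYes≗does (≡-dec Fin._≟_ Fin._≟_ (outputOn P A B (a , b)) (i , j)))
        (cong (λ ω → does (≡-dec Fin._≟_ Fin._≟_ (outputOn P A B ω) (i , j))) (sym (Fin.remQuot-combine a b)))))
      (trans (sym (sum-combine (randA P) λ x → ind (does (≡-dec Fin._≟_ Fin._≟_ (out x) (i , j)) ∧ Trimmed.event x)))
        (Trimmed.event-part i j (dec-true (¬? ((A ⊗ B) i j ℤ.≟ 0ℤ)) ne))))

    E≢0 : NonZero (count E)
    E≢0 = subst NonZero (sym count-E) (ℕ.m*n≢0 q N)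

    success : 1ℚ ℚ.- (ℤ.+ 1 / 10) ℚ.≤ Pr[_] P E
    success = /-mono-≤ 9 10 (count E) M {{_}} {{ℕ.m*n≢0 (randA P) (randB P)}}
      (ℕ.≤-trans 9M≤ (ℕ.≤-reflexive (trans (lemma q N) (cong (_* 10) (sym count-E)))))
      where
      lemma : ∀ q N → q * (10 * N) ≡ q * N * 10
      lemma = solve-∀

    part-ratio : ∀ i j → (A ⊗ B) i j ≢ 0ℤ → 1 * count E ≡ count (both i j) * N
    part-ratio i j ne = trans (ℕ.*-identityˡ (count E)) (trans count-E (cong (_* N) (sym (count-both i j ne))))

-- The communication bound.

floor-≤ : ∀ p → ℚ.floor p ℤ.* ℚ.↧ p ℤ.≤ ℚ.↥ p
floor-≤ p@record{} = ℤ.[n/d]*d≤n (ℚ.↥ p) (ℚ.↧ p)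

≤-ceiling : ∀ m (p : ℚ) → ℤ.+ m / 1 ℚ.≤ p → m ≤ ℤ.∣ ℚ.ceiling p ∣
≤-ceiling m p@record{} m≤p = ≤-∣∣ (ℤ.*-cancelʳ-≤-pos (ℤ.+ m) (ℚ.ceiling p) (ℚ.↧ p) (begin
  ℤ.+ m ℤ.* ℚ.↧ p                               ≤⟨ numerators ⟩
  ℚ.↥ p                                         ≡⟨ ℤ.neg-involutive (ℚ.↥ p) ⟨
  ℤ.- (ℤ.- ℚ.↥ p)                               ≡⟨ cong ℤ.-_ (ℚ.↥-neg p) ⟨
  ℤ.- ℚ.↥ (ℚ.- p)                               ≤⟨ ℤ.neg-mono-≤ (floor-≤ (ℚ.- p)) ⟩
  ℤ.- (ℚ.floor (ℚ.- p) ℤ.* ℚ.↧ (ℚ.- p))         ≡⟨ ℤ.neg-distribˡ-* (ℚ.floor (ℚ.- p)) (ℚ.↧ (ℚ.- p)) ⟩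
  ℚ.ceiling p ℤ.* ℚ.↧ (ℚ.- p)                   ≡⟨ cong (ℚ.ceiling p ℤ.*_) (ℚ.↧-neg p) ⟩
  ℚ.ceiling p ℤ.* ℚ.↧ p                         ∎))
  where
  open ℤ.≤-Reasoning
  ≤-∣∣ : ∀ {m z} → ℤ.+ m ℤ.≤ z → m ≤ ℤ.∣ z ∣
  ≤-∣∣ (ℤ.+≤+ m≤z) = m≤z
  numerators : ℤ.+ m ℤ.* ℚ.↧ p ℤ.≤ ℚ.↥ p
  numerators = subst (ℤ.+ m ℤ.* ℚ.↧ p ℤ.≤_) (ℤ.*-identityʳ (ℚ.↥ p)) (ℚᵘ.drop-*≤*
    (ℚᵘ.≤-respˡ-≃ (ℚ.toℚᵘ-fromℚᵘ (mkℚᵘ (ℤ.+ m) 0)) (ℚ.toℚᵘ-mono-≤ m≤p)))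

≤-÷ : ∀ p q r .{{_ : Positive r}} → p ℚ.* r ℚ.≤ q → p ℚ.≤ (q ℚ.÷ r) {{ℚ.pos⇒nonZero r}}
≤-÷ p q r pr≤q = ℚ.*-cancelʳ-≤-pos r (subst (p ℚ.* r ℚ.≤_) (sym (begin
  q ℚ.* 1/r ℚ.* r     ≡⟨ ℚ.*-assoc q 1/r r ⟩
  q ℚ.* (1/r ℚ.* r)   ≡⟨ cong (q ℚ.*_) (ℚ.*-inverseˡ r {{ℚ.pos⇒nonZero r}}) ⟩
  q ℚ.* 1ℚ            ≡⟨ ℚ.*-identityʳ q ⟩
  q                   ∎)) pr≤q)
  where
  open ≡-Reasoning
  1/r = ℚ.1/_ r {{ℚ.pos⇒nonZero r}}

nat*≤ : ∀ m {p q} → p ℚ.≤ q → ℤ.+ m / 1 ℚ.* p ℚ.≤ ℤ.+ m / 1 ℚ.* q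
nat*≤ m = ℚ.*-monoˡ-≤-nonNeg (ℤ.+ m / 1) {{ℚ.normalize-nonNeg m 1}}

double-half : ∀ m → ℤ.+ (2 * m) / 1 ℚ.* ½ ≡ ℤ.+ m / 1
double-half m = ℚ.toℚᵘ-injective (begin-equality
  ℚ.toℚᵘ (ℤ.+ (2 * m) / 1 ℚ.* ½)                ≃⟨ ℚ.toℚᵘ-homo-* (ℤ.+ (2 * m) / 1) ½ ⟩
  ℚ.toℚᵘ (ℤ.+ (2 * m) / 1) ℚᵘ.* ℚ.toℚᵘ ½        ≃⟨ ℚᵘ.*-congʳ (ℚ.toℚᵘ-fromℚᵘ (mkℚᵘ (ℤ.+ (2 * m)) 0)) ⟩
  mkℚᵘ (ℤ.+ (2 * m)) 0 ℚᵘ.* ℚ.toℚᵘ ½            ≃⟨ ℚᵘ.*≡* halve ⟩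
  mkℚᵘ (ℤ.+ m) 0                                ≃⟨ ℚ.toℚᵘ-fromℚᵘ (mkℚᵘ (ℤ.+ m) 0) ⟨
  ℚ.toℚᵘ (ℤ.+ m / 1)                            ∎)
  where
  open ℚᵘ.≤-Reasoning
  halve : ℤ.+ (2 * m) ℤ.* ℤ.+ 1 ℤ.* ℤ.+ 1 ≡ ℤ.+ m ℤ.* ℤ.+ 2
  halve = trans (ℤ.*-identityʳ _) (trans (ℤ.*-identityʳ _) (trans (cong ℤ.+_ (ℕ.*-comm 2 m)) (ℤ.pos-* m 2)))

-- The numbers sent go up to `n` inclusive, so strictness matters. The factor 2 provides it: if `n`
-- were at least 2 to the power L, then `m` would be at least 2 to the power L + 1, and its
-- logarithm would exceed L.
n<2^⌈log₂⌉ : ∀ {n m} → 2 * n ≤ m → .{{_ : NonZero n}} → n ℕ.< 2 ^ ⌈log₂ m ⌉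
n<2^⌈log₂⌉ {n} {m} 2n≤m = ℕ.≰⇒> λ 2^L≤n → ℕ.1+n≰n (begin
  suc ⌈log₂ m ⌉                 ≡⟨ ⌈log₂2^n⌉≡n (suc ⌈log₂ m ⌉) ⟨
  ⌈log₂ 2 ^ suc ⌈log₂ m ⌉ ⌉     ≤⟨ ⌈log₂⌉-mono-≤ (ℕ.≤-trans (ℕ.*-monoʳ-≤ 2 2^L≤n) 2n≤m) ⟩
  ⌈log₂ m ⌉                     ∎)
  where open ℕ.≤-Reasoning

module _ (ε : ℚ) .{{_ : Positive ε}} (ε≤1 : ε ℚ.≤ 1ℚ) where

  private
    δ : ℚ
    δ = ℤ.+ 1 / 10

    instance
      εδ>0 : Positive (ε ℚ.* δ)
      εδ>0 = ℚ.pos*pos⇒pos ε δ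
      εε>0 : Positive (ε ℚ.* ε)
      εε>0 = ℚ.pos*pos⇒pos ε ε

    εε≤1 : ε ℚ.* ε ℚ.≤ 1ℚ
    εε≤1 = ℚ.≤-trans (ℚ.*-monoʳ-≤-nonNeg ε {{ℚ.pos⇒nonNeg ε}} ε≤1)
                     (ℚ.≤-trans (ℚ.≤-reflexive (ℚ.*-identityˡ ε)) ε≤1)

    -- The error probability 1/10 supplies the factor 2 that `n<2^⌈log₂⌉` asks for.
    εδ≤½ : ε ℚ.* δ ℚ.≤ ½
    εδ≤½ = ℚ.≤-trans (ℚ.*-monoʳ-≤-nonNeg δ ε≤1) (/-mono-≤ 1 10 1 2 (ℕ.m≤m+n 2 8))

  n<2^logFactor : ∀ n .{{_ : NonZero n}} → n ℕ.< 2 ^ logFactor n ε δ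
  n<2^logFactor n = n<2^⌈log₂⌉ (≤-ceiling (2 * n) _ (≤-÷ (ℤ.+ (2 * n) / 1) (ℤ.+ n / 1) (ε ℚ.* δ)
    (ℚ.≤-trans (nat*≤ (2 * n) εδ≤½) (ℚ.≤-reflexive (double-half n)))))

  -- The cost itself is free of `ε`, and dividing by ε² ≤ 1 only enlarges it.
  ≤-n/ε²-bound : ∀ K k n → ℤ.+ (K * n * logFactor n ε δ ^ k) / 1 ℚ.≤ n/ε²-bound K k n ε δ
  ≤-n/ε²-bound K k n = ≤-÷ x x (ε ℚ.* ε) (subst (x ℚ.* (ε ℚ.* ε) ℚ.≤_) (ℚ.*-identityʳ x) (nat*≤ (K * n * logFactor n ε δ ^ k) εε≤1))
    where
    x : ℚ
    x = ℤ.+ (K * n * logFactor n ε δ ^ k) / 1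

-- Assembling the sampler.

sampler-lower : ∀ {n} i₀ w (n<2^w : n ℕ.< 2 ^ w) A B i j → support A B j i ≡ true →
  let P = Sampler.sampler i₀ w n<2^w in
  9 * (randA P * randB P) ≤ 10 * (‖ A ⊗ B ‖₀ * outcomes P A B i j)
sampler-lower {n} i₀ w n<2^w A B i j Sji = ℕ.≤-trans (hits-lower (support A B) i j Sji)
  (ℕ.*-monoʳ-≤ 10 (ℕ.*-mono-≤ (ℕ.≤-reflexive (sym (‖‖₀-support A B))) (Sampler.outputs-lower i₀ w n<2^w A B i j)))

first-index : ∀ n .{{_ : NonZero n}} → Fin n
first-index (suc n) = zero

sampler-exists : ∀ ε .{{_ : NonNegative ε}} n .{{_ : NonZero n}} w → n ℕ.< 2 ^ w →
  ∀ c → ℤ.+ (14 * n * w ^ 1) / 1 ℚ.≤ c →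
  Σ[ P ∈ MatrixProtocol n ] ℓ₀-Sampler ε (ℤ.+ 1 / 10) P × CostAtMost P c × HasRounds P 1
sampler-exists ε n w n<2^w c cost≤c =
    sampler
  , lower⇒ℓ₀-Sampler sampler (sampler-lower (first-index n) w n<2^w) ε
  , (λ A B ω → subst (λ b → ℤ.+ b / 1 ℚ.≤ c) (sym (bits-sampler A B ω)) cost≤c)
  , rounds-sampler
  where open Sampler (first-index n) w n<2^w

open import Data.Integer.Base using (+_)
open import Data.Rational.Base using (_<_)

theorem3p2 :
    ∃[ K ] ∃[ k ]
      ∀ (ε : ℚ) .{{_ : Positive ε}} → ε < 1ℚ →
      ∀ (n : ℕ) .{{_ : NonZero n}} →
      Σ[ P ∈ MatrixProtocol n ]
        ℓ₀-Sampler ε (+ 1 / 10) P ×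
        CostAtMost P (n/ε²-bound K k n ε (+ 1 / 10)) ×
        HasRounds P 1
-- Alice sends 14 numbers per column of `A`, each in `logFactor` bits, hence the exponent 1.
theorem3p2 = 14 , 1 , λ ε ε<1 n →
  sampler-exists ε {{ℚ.pos⇒nonNeg ε}} n (logFactor n ε (+ 1 / 10)) (n<2^logFactor ε (ℚ.<⇒≤ ε<1) n)
    (n/ε²-bound 14 1 n ε (+ 1 / 10)) (≤-n/ε²-bound ε (ℚ.<⇒≤ ε<1) 14 1 n)
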